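{- There exists a constant $c>0$ such that for all sufficiently large $n$ and all $r\ge0$, $0<\epsilon\le 1$, $R>\epsilon$, with probability at least $1-1/n$ the flooding time of the stationary geometric-MEG $\mathcal{G}(n,r,R,\epsilon)$ is at least $c\,\frac{\sqrt n}{R+r}$.
   Context: $L_{n,\epsilon}=\{(i\epsilon,j\epsilon): i,j\in\mathbb{N},\ i,j\le\sqrt n/\epsilon\}$; $\Gamma(\mathbf{x})=\{\mathbf{y}\in L_{n,\epsilon}:d(\mathbf{x},\mathbf{y})\le r\}$ with $d$ Euclidean distance. Each node $i\in[n]$ has position $P_{i,t}\in L_{n,\epsilon}$ evolving independently as a Markov chain that moves from $\mathbf{x}$ to a uniform random point of $\Gamma(\mathbf{x})$. The geometric-MEG $\mathcal{G}(n,r,R,\epsilon)=\{G_t\}$ has $G_t=([n],E_t)$, $E_t=\{\{i,j\}: d(P_{i,t},P_{j,t})\le R\}$. It is stationary when the initial positions are independent with law $\pi(\mathbf{x})=|\Gamma(\mathbf{x})|/\sum_{\mathbf{y}}|\Gamma(\mathbf{y})|$. Flooding from source $s$: $I_0=\{s\}$, $I_{t+1}=I_t\cup N_t(I_t)$, where $N_t(I)$ is the set of nodes outside $I$ adjacent in $G_t$ to a node of $I$; $T(s)$ is the first $t$ with $I_t=[n]$, and the flooding time is $\max_s T(s)$. -}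

module Defs where

open import Algebra.Bundles using (CommutativeRing)
open import Algebra.Structures using (IsCommutativeRing)
import Algebra.Properties.Ring as RingProperties
import Algebra.Solver.Ring.NaturalCoefficients.Default as SemiringSolver
open import Data.Bool.Base using (if_then_else_)
import Data.Bool.Properties as Bool
open import Data.Empty using (⊥-elim)
open import Data.Fin.Base using (Fin; toℕ)
import Data.Fin.Properties as Fin
open import Data.Fin.Subset using (Subset; ⊤; ⁅_⁆; _∪_; _∈_; _∉_)
open import Data.Fin.Subset.Properties using (_∈?_)
open import Data.List.Base as List using (List; []; _∷_; allFin; cartesianProduct; cartesianProductWith; filter; length)
open import Data.Nat.Base as ℕ using (ℕ; zero; suc; z≤n; s≤s)
open import Data.Nat.GeneralisedArithmetic using (fold)
import Data.Nat.Properties as ℕ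
open import Data.Product.Base using (∃; _×_; _,_; proj₁; proj₂)
open import Data.Sum.Base using (inj₁; inj₂)
open import Data.Vec.Base as Vec using (Vec; []; _∷_; lookup; tabulate)
import Data.Vec.Properties as Vec
open import Relation.Binary.Bundles using (Poset)
import Relation.Binary.Construct.NonStrictToStrict as ToStrict
import Relation.Binary.Reasoning.PartialOrder as PosetReasoning
open import Relation.Binary.PropositionalEquality as ≡ using (_≡_; _≢_)
open import Relation.Binary.Structures using (IsDecTotalOrder)
open import Relation.Nullary using (¬_; Dec; yes; no; does)
open import Relation.Nullary.Decidable using (map′; ¬?; _×-dec_; _→-dec_)

-- The real numbers, axiomatised as a Dedekind-complete ordered field (which
-- determines them up to isomorphism).  Order and equality are decidable, as
-- they are classically, so that for instance |Γ(x)| is a number.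
-- The inverse is total; its value at 0 is unspecified.  The Archimedean property
-- is listed because completeness yields its witness only up to double negation
-- without excluded middle.
record CompleteOrderedField : Set₁ where
  infixl 7 _*_ _/_
  infixl 6 _+_ _-_
  infix  8 -_ _⁻¹
  infix  4 _≈_ _≤_ _<_
  field
    Carrier           : Set
    _≈_ _≤_           : Carrier → Carrier → Set
    _+_ _*_           : Carrier → Carrier → Carrier
    -_ _⁻¹            : Carrier → Carrier
    0# 1#             : Carrier
    isCommutativeRing : IsCommutativeRing _≈_ _+_ _*_ -_ 0# 1#
    isDecTotalOrder   : IsDecTotalOrder _≈_ _≤_
    0≉1               : ¬ (0# ≈ 1#)
    *-inverseʳ        : ∀ x → ¬ (x ≈ 0#) → x * x ⁻¹ ≈ 1#
    +-monoˡ-≤         : ∀ z {x y} → x ≤ y → x + z ≤ y + z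
    *-nonneg          : ∀ {x y} → 0# ≤ x → 0# ≤ y → 0# ≤ x * y
    supremum          : (P : Carrier → Set) → ∃ P → (∃ λ b → ∀ x → P x → x ≤ b) →
                        ∃ λ s → (∀ x → P x → x ≤ s) ×
                                (∀ b → (∀ x → P x → x ≤ b) → s ≤ b)

  fromℕ : ℕ → Carrier
  fromℕ = fold 0# (1# +_)

  field
    archimedean       : ∀ x → ∃ λ k → x ≤ fromℕ k

  _<_ : Carrier → Carrier → Set
  _<_ = ToStrict._<_ _≈_ _≤_

  _-_ : Carrier → Carrier → Carrier
  x - y = x + - y

  _/_ : Carrier → Carrier → Carrier
  x / y = x * y ⁻¹

  commutativeRing : CommutativeRing _ _
  commutativeRing = record { isCommutativeRing = isCommutativeRing }

  open IsDecTotalOrder isDecTotalOrder public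
    using (_≟_; _≤?_; total; antisym; isPartialOrder)
    renaming (refl to ≤-refl; reflexive to ≤-reflexive; trans to ≤-trans)

  poset : Poset _ _ _
  poset = record { isPartialOrder = isPartialOrder }

module RealFunctions (𝓡 : CompleteOrderedField) where
  open CompleteOrderedField 𝓡
  open CommutativeRing commutativeRing
    using (ring; commutativeSemiring; +-comm; +-cong; +-congˡ; +-congʳ; +-assoc; +-identityˡ; +-identityʳ;
           -‿inverseˡ; -‿inverseʳ; -‿cong; *-comm; *-cong; *-congˡ; *-congʳ; *-assoc; *-identityˡ; *-identityʳ;
           distribˡ; zeroˡ; zeroʳ)
    renaming (refl to ≈-refl; sym to ≈-sym; trans to ≈-trans)
  open RingProperties ring using (-‿distribˡ-*; -‿distribʳ-*; -‿involutive)
  open SemiringSolver commutativeSemiring using (solve; _:=_; _:+_; _:*_)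
  open PosetReasoning poset

  +-monoʳ-≤ : ∀ z {x y} → x ≤ y → z + x ≤ z + y
  +-monoʳ-≤ z {x} {y} x≤y = begin
    z + x  ≈⟨ +-comm z x ⟩
    x + z  ≤⟨ +-monoˡ-≤ z x≤y ⟩
    y + z  ≈⟨ +-comm y z ⟩
    z + y  ∎

  +-cancelʳ-≤ : ∀ z {x y} → x + z ≤ y + z → x ≤ y
  +-cancelʳ-≤ z {x} {y} le = begin
    x            ≈⟨ undo x ⟨
    x + z + - z  ≤⟨ +-monoˡ-≤ (- z) le ⟩
    y + z + - z  ≈⟨ undo y ⟩
    y            ∎
    where
    undo : ∀ w → w + z + - z ≈ w
    undo w = ≈-trans (+-assoc w z (- z)) (≈-trans (+-congˡ (-‿inverseʳ z)) (+-identityʳ w))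

  x≤y⇒0≤y-x : ∀ {x y} → x ≤ y → 0# ≤ y - x
  x≤y⇒0≤y-x {x} {y} x≤y = begin
    0#     ≈⟨ -‿inverseʳ x ⟨
    x - x  ≤⟨ +-monoˡ-≤ (- x) x≤y ⟩
    y - x  ∎

  x+[y-x]≈y : ∀ x y → x + (y - x) ≈ y
  x+[y-x]≈y x y = ≈-trans (+-comm x (y - x))
    (≈-trans (+-assoc y (- x) x) (≈-trans (+-congˡ (-‿inverseˡ x)) (+-identityʳ y)))

  +-nonneg : ∀ {x y} → 0# ≤ x → 0# ≤ y → 0# ≤ x + y
  +-nonneg {x} {y} 0≤x 0≤y = begin
    0#      ≤⟨ 0≤x ⟩
    x       ≈⟨ +-identityʳ x ⟨
    x + 0#  ≤⟨ +-monoʳ-≤ x 0≤y ⟩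
    x + y   ∎

  *-monoˡ-≤ : ∀ {z x y} → 0# ≤ z → x ≤ y → z * x ≤ z * y
  *-monoˡ-≤ {z} {x} {y} 0≤z x≤y = begin
    z * x                ≈⟨ +-identityʳ _ ⟨
    z * x + 0#           ≤⟨ +-monoʳ-≤ _ (*-nonneg 0≤z (x≤y⇒0≤y-x x≤y)) ⟩
    z * x + z * (y - x)  ≈⟨ distribˡ z x (y - x) ⟨
    z * (x + (y - x))    ≈⟨ *-congˡ (x+[y-x]≈y x y) ⟩
    z * y                ∎

  -x*-x≈x*x : ∀ x → - x * - x ≈ x * x
  -x*-x≈x*x x = ≈-trans (≈-sym (-‿distribˡ-* x (- x)))
    (≈-trans (-‿cong (≈-sym (-‿distribʳ-* x x))) (-‿involutive _))

  0≤x*x : ∀ x → 0# ≤ x * x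
  0≤x*x x with total 0# x
  ... | inj₁ 0≤x = *-nonneg 0≤x 0≤x
  ... | inj₂ x≤0 = ≤-trans (*-nonneg 0≤-x 0≤-x) (≤-reflexive (-x*-x≈x*x x))
    where
    0≤-x : 0# ≤ - x
    0≤-x = ≤-trans (x≤y⇒0≤y-x x≤0) (≤-reflexive (+-identityˡ (- x)))

  0≤1 : 0# ≤ 1#
  0≤1 = ≤-trans (0≤x*x 1#) (≤-reflexive (*-identityˡ 1#))

  1≰0 : ¬ (1# ≤ 0#)
  1≰0 1≤0 = 0≉1 (antisym 0≤1 1≤0)

  x≤x+y : ∀ x {y} → 0# ≤ y → x ≤ x + y
  x≤x+y x 0≤y = ≤-trans (≤-reflexive (≈-sym (+-identityʳ x))) (+-monoʳ-≤ x 0≤y)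

  ⁻¹-nonneg : ∀ {x} → 0# ≤ x → ¬ (x ≈ 0#) → 0# ≤ x ⁻¹
  ⁻¹-nonneg {x} 0≤x x≉0 with total 0# (x ⁻¹)
  ... | inj₁ 0≤x⁻¹ = 0≤x⁻¹
  ... | inj₂ x⁻¹≤0 = ⊥-elim (1≰0 (begin
    1#        ≈⟨ *-inverseʳ x x≉0 ⟨
    x * x ⁻¹  ≤⟨ *-monoˡ-≤ 0≤x x⁻¹≤0 ⟩
    x * 0#    ≈⟨ zeroʳ x ⟩
    0#        ∎))

  2xy≤x²+y² : ∀ x y → x * y + x * y ≤ x * x + y * y
  2xy≤x²+y² x y = begin
    x * y + x * y                        ≤⟨ x≤x+y _ (0≤x*x d) ⟩
    (x * y + x * y) + d * d              ≈⟨ +-congʳ (+-cong x*y x*y) ⟩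
    (x * (x + d) + x * (x + d)) + d * d  ≈⟨ solve 2 (λ x d → (x :* (x :+ d) :+ x :* (x :+ d)) :+ d :* d
                                                          := x :* x :+ (x :+ d) :* (x :+ d)) ≈-refl x d ⟩
    x * x + (x + d) * (x + d)            ≈⟨ +-congˡ (*-cong (x+[y-x]≈y x y) (x+[y-x]≈y x y)) ⟩
    x * x + y * y                        ∎
    where
    d = y - x
    x*y : x * y ≈ x * (x + d)
    x*y = *-congˡ (≈-sym (x+[y-x]≈y x y))

  squareRoot : ∀ a → 0# ≤ a → ∃ λ s → 0# ≤ s × s * s ≈ a
  squareRoot a 0≤a = s , 0≤s , antisym s²≤a a≤s²
    where
    P : Carrier → Set
    P x = x * x ≤ a

    P0 : P 0#
    P0 = ≤-trans (≤-reflexive (zeroˡ 0#)) 0≤a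

    bound : ∀ x → P x → x ≤ 1# + a
    bound x x²≤a with total x (1# + a)
    ... | inj₁ x≤1+a = x≤1+a
    ... | inj₂ 1+a≤x = begin
      x       ≈⟨ *-identityʳ x ⟨
      x * 1#  ≤⟨ *-monoˡ-≤ (≤-trans 0≤1 1≤x) 1≤x ⟩
      x * x   ≤⟨ x²≤a ⟩
      a       ≤⟨ x≤x+y a 0≤1 ⟩
      a + 1#  ≈⟨ +-comm a 1# ⟩
      1# + a  ∎
      where
      1≤x : 1# ≤ x
      1≤x = ≤-trans (x≤x+y 1# 0≤a) 1+a≤x

    lub = supremum P (0# , P0) (1# + a , bound)
    s   = proj₁ lub

    upper : ∀ x → P x → x ≤ s
    upper = proj₁ (proj₂ lub)

    0≤s : 0# ≤ s
    0≤s = upper 0# P0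

    s²≤a : s * s ≤ a
    s²≤a with s ≟ 0#
    ... | yes s≈0 = ≤-trans (≤-reflexive (≈-trans (*-cong s≈0 s≈0) (zeroˡ 0#))) 0≤a
    ... | no  s≉0 = +-cancelʳ-≤ (s * s) (begin
      s * s + s * s          ≈⟨ distribˡ s s s ⟨
      s * (s + s)            ≈⟨ *-comm s (s + s) ⟩
      (s + s) * s            ≤⟨ *-monoˡ-≤ 0≤2s s≤t ⟩
      (s + s) * t            ≈⟨ *-assoc (s + s) _ _ ⟨
      (s + s) * (s + s) ⁻¹ * (a + s * s) ≈⟨ *-congʳ (*-inverseʳ (s + s) 2s≉0) ⟩
      1# * (a + s * s)       ≈⟨ *-identityˡ _ ⟩
      a + s * s              ∎)
      where
      0≤2s : 0# ≤ s + s
      0≤2s = +-nonneg 0≤s 0≤s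

      2s≉0 : ¬ (s + s ≈ 0#)
      2s≉0 2s≈0 = s≉0 (antisym (≤-trans (x≤x+y s 0≤s) (≤-reflexive 2s≈0)) 0≤s)

      t = (s + s) ⁻¹ * (a + s * s)

      t-bound : ∀ x → P x → x ≤ t
      t-bound x x²≤a = begin
        x                              ≈⟨ *-identityˡ x ⟨
        1# * x                         ≈⟨ *-congʳ (*-inverseʳ (s + s) 2s≉0) ⟨
        (s + s) * (s + s) ⁻¹ * x       ≈⟨ solve 3 (λ s i x → (s :+ s) :* i :* x := i :* (x :* s :+ x :* s)) ≈-refl s ((s + s) ⁻¹) x ⟩
        (s + s) ⁻¹ * (x * s + x * s)   ≤⟨ *-monoˡ-≤ (⁻¹-nonneg 0≤2s 2s≉0) (2xy≤x²+y² x s) ⟩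
        (s + s) ⁻¹ * (x * x + s * s)   ≤⟨ *-monoˡ-≤ (⁻¹-nonneg 0≤2s 2s≉0) (+-monoˡ-≤ (s * s) x²≤a) ⟩
        t                              ∎

      s≤t : s ≤ t
      s≤t = proj₂ (proj₂ lub) t t-bound

    a≤s² : a ≤ s * s
    a≤s² = begin
      a            ≈⟨ x+[y-x]≈y (s * s) a ⟨
      s * s + e    ≤⟨ +-monoʳ-≤ (s * s) e≤0 ⟩
      s * s + 0#   ≈⟨ +-identityʳ _ ⟩
      s * s        ∎
      where
      e   = a - s * s
      den = e + (s + s + 1#)
      δ   = den ⁻¹ * e

      0≤e : 0# ≤ e
      0≤e = x≤y⇒0≤y-x s²≤a

      1≤den : 1# ≤ den
      1≤den = begin
        1#                   ≤⟨ x≤x+y 1# (+-nonneg 0≤e (+-nonneg 0≤s 0≤s)) ⟩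
        1# + (e + (s + s))   ≈⟨ +-comm 1# _ ⟩
        e + (s + s) + 1#     ≈⟨ +-assoc e (s + s) 1# ⟩
        den                  ∎

      0≤den : 0# ≤ den
      0≤den = ≤-trans 0≤1 1≤den

      den≉0 : ¬ (den ≈ 0#)
      den≉0 den≈0 = 1≰0 (≤-trans 1≤den (≤-reflexive den≈0))

      den*δ≈e : den * δ ≈ e
      den*δ≈e = ≈-trans (≈-sym (*-assoc den _ e))
        (≈-trans (*-congʳ (*-inverseʳ den den≉0)) (*-identityˡ e))

      0≤δ : 0# ≤ δ
      0≤δ = *-nonneg (⁻¹-nonneg 0≤den den≉0) 0≤e

      δ≤1 : δ ≤ 1#
      δ≤1 = begin
        den ⁻¹ * e    ≤⟨ *-monoˡ-≤ (⁻¹-nonneg 0≤den den≉0) (x≤x+y e (+-nonneg (+-nonneg 0≤s 0≤s) 0≤1)) ⟩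
        den ⁻¹ * den  ≈⟨ *-comm _ den ⟩
        den * den ⁻¹  ≈⟨ *-inverseʳ den den≉0 ⟩
        1#            ∎

      P-s+δ : P (s + δ)
      P-s+δ = begin
        (s + δ) * (s + δ)             ≈⟨ solve 2 (λ s d → (s :+ d) :* (s :+ d) := s :* s :+ d :* (s :+ s :+ d)) ≈-refl s δ ⟩
        s * s + δ * (s + s + δ)       ≤⟨ +-monoʳ-≤ _ (*-monoˡ-≤ 0≤δ (+-monoʳ-≤ _ δ≤1)) ⟩
        s * s + δ * (s + s + 1#)      ≤⟨ +-monoʳ-≤ _ (*-monoˡ-≤ 0≤δ (≤-trans (x≤x+y _ 0≤e) (≤-reflexive (+-comm _ e)))) ⟩
        s * s + δ * den               ≈⟨ +-congˡ (≈-trans (*-comm δ den) den*δ≈e) ⟩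
        s * s + e                     ≈⟨ x+[y-x]≈y (s * s) a ⟩
        a                             ∎

      δ≤0 : δ ≤ 0#
      δ≤0 = +-cancelʳ-≤ s (begin
        δ + s   ≈⟨ +-comm δ s ⟩
        s + δ   ≤⟨ upper (s + δ) P-s+δ ⟩
        s       ≈⟨ +-identityˡ s ⟨
        0# + s  ∎)

      e≤0 : e ≤ 0#
      e≤0 = begin
        e         ≈⟨ den*δ≈e ⟨
        den * δ   ≤⟨ *-monoˡ-≤ 0≤den δ≤0 ⟩
        den * 0#  ≈⟨ zeroʳ den ⟩
        0#        ∎

  infix 9 √_

  -- Only used on non-negative arguments; the value elsewhere is irrelevant.
  √_ : Carrier → Carrier
  √ a with 0# ≤? a
  ... | yes 0≤a = proj₁ (squareRoot a 0≤a)
  ... | no  _   = 0#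

  √-spec : ∀ {a} → 0# ≤ a → 0# ≤ √ a × √ a * √ a ≈ a
  √-spec {a} 0≤a with 0# ≤? a
  ... | yes p = proj₂ (squareRoot a p)
  ... | no ¬p = ⊥-elim (¬p 0≤a)

  fromℕ-mono : ∀ {j k} → j ℕ.≤ k → fromℕ j ≤ fromℕ k
  fromℕ-mono {k = zero}  z≤n = ≤-refl
  fromℕ-mono {k = suc k} z≤n = +-nonneg 0≤1 (fromℕ-mono {k = k} z≤n)
  fromℕ-mono (s≤s j≤k)       = +-monoʳ-≤ 1# (fromℕ-mono j≤k)

  floorBelow : Carrier → ℕ → ℕ
  floorBelow x zero = zero
  floorBelow x (suc k) with fromℕ (suc k) ≤? x
  ... | yes _ = suc k
  ... | no  _ = floorBelow x k

  floorBelow-spec : ∀ x k → 0# ≤ x → fromℕ (floorBelow x k) ≤ x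
  floorBelow-spec x zero    0≤x = 0≤x
  floorBelow-spec x (suc k) 0≤x with fromℕ (suc k) ≤? x
  ... | yes p = p
  ... | no  _ = floorBelow-spec x k 0≤x

  floorBelow-max : ∀ x k i → i ℕ.≤ k → fromℕ i ≤ x → i ℕ.≤ floorBelow x k
  floorBelow-max x zero    i i≤k _   = i≤k
  floorBelow-max x (suc k) i i≤k i≤x with fromℕ (suc k) ≤? x
  ... | yes _ = i≤k
  ... | no ¬p with ℕ.m≤n⇒m<n∨m≡n i≤k
  ...   | inj₁ i<1+k  = floorBelow-max x k i (ℕ.≤-pred i<1+k) i≤x
  ...   | inj₂ ≡.refl = ⊥-elim (¬p i≤x)

  -- The largest k ∈ ℕ with k ≤ x, for x ≥ 0 (and 0 for x < 0).
  ⌊_⌋ : Carrier → ℕ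
  ⌊ x ⌋ = floorBelow x (suc (proj₁ (archimedean x)))

  ⌊⌋-lower : ∀ {x} → 0# ≤ x → fromℕ ⌊ x ⌋ ≤ x
  ⌊⌋-lower {x} = floorBelow-spec x (suc (proj₁ (archimedean x)))

  ⌊⌋-max : ∀ {x} i → fromℕ i ≤ x → i ℕ.≤ ⌊ x ⌋
  ⌊⌋-max {x} i i≤x with ℕ.≤-total i (suc (proj₁ (archimedean x)))
  ... | inj₁ i≤k = floorBelow-max x _ i i≤k i≤x
  ... | inj₂ k<i = ⊥-elim (1≰0 (+-cancelʳ-≤ (fromℕ k) (begin
    1# + fromℕ k  ≤⟨ fromℕ-mono k<i ⟩
    fromℕ i       ≤⟨ i≤x ⟩
    x             ≤⟨ proj₂ (archimedean x) ⟩
    fromℕ k       ≈⟨ +-identityˡ _ ⟨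
    0# + fromℕ k  ∎)))
    where
    k = proj₁ (archimedean x)

allVecs : ∀ {A : Set} → List A → (m : ℕ) → List (Vec A m)
allVecs xs zero    = [] ∷ []
allVecs xs (suc m) = cartesianProductWith _∷_ xs (allVecs xs m)

module GeometricMEG (𝓡 : CompleteOrderedField) (n : ℕ) (r R ε : CompleteOrderedField.Carrier 𝓡) where
  open CompleteOrderedField 𝓡
  open RealFunctions 𝓡 using (√_; ⌊_⌋; fromℕ-mono)

  -- L_{n,ε}: the pair of indices (i , j) stands for the point (iε , jε).
  -- By ⌊⌋-lower and ⌊⌋-max, i ranges over exactly the naturals ≤ √n / ε.
  Point : Set
  Point = Fin (suc ⌊ √ fromℕ n / ε ⌋) × Fin (suc ⌊ √ fromℕ n / ε ⌋)

  points : List Point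
  points = cartesianProduct (allFin _) (allFin _)

  dist : Point → Point → Carrier
  dist (i , j) (i′ , j′) = √ (Δ i i′ * Δ i i′ + Δ j j′ * Δ j j′)
    where
    Δ : Fin (suc ⌊ √ fromℕ n / ε ⌋) → Fin (suc ⌊ √ fromℕ n / ε ⌋) → Carrier
    Δ a b = fromℕ (toℕ a) * ε - fromℕ (toℕ b) * ε

  Γ : Point → List Point
  Γ x = filter (λ y → dist x y ≤? r) points

  ∣Γ∣ : Point → ℕ
  ∣Γ∣ x = length (Γ x)

  stationary : Point → Carrier
  stationary x = fromℕ (∣Γ∣ x) / fromℕ (List.sum (List.map ∣Γ∣ points))

  step : Point → Point → Carrier
  step x y = if does (dist x y ≤? r) then 1# / fromℕ (∣Γ∣ x) else 0#

  -- The positions of all nodes at one time, and along the whole process.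
  Config : Set
  Config = Vec Point n

  Path : Set
  Path = ℕ → Config

  pos : Path → Fin n → ℕ → Point
  pos ω i t = lookup (ω t) i

  Adjacent : Path → ℕ → Fin n → Fin n → Set
  Adjacent ω t i j = i ≢ j × dist (pos ω i t) (pos ω j t) ≤ R

  adjacent? : ∀ ω t i j → Dec (Adjacent ω t i j)
  adjacent? ω t i j = ¬? (i Fin.≟ j) ×-dec (dist (pos ω i t) (pos ω j t) ≤? R)

  InNeighbourhood : Path → ℕ → Subset n → Fin n → Set
  InNeighbourhood ω t I j = j ∉ I × ∃ λ i → i ∈ I × Adjacent ω t i j

  inNeighbourhood? : ∀ ω t I j → Dec (InNeighbourhood ω t I j)
  inNeighbourhood? ω t I j = ¬? (j ∈? I) ×-dec Fin.any? (λ i → (i ∈? I) ×-dec adjacent? ω t i j)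

  N : Path → ℕ → Subset n → Subset n
  N ω t I = tabulate (λ j → does (inNeighbourhood? ω t I j))

  informed : Path → Fin n → ℕ → Subset n
  informed ω s zero    = ⁅ s ⁆
  informed ω s (suc t) = informed ω s t ∪ N ω t (informed ω s t)

  -- T(s) = t
  IsCompletionTime : Path → Fin n → ℕ → Set
  IsCompletionTime ω s t = informed ω s t ≡ ⊤ × (∀ {u} → u ℕ.< t → informed ω s u ≢ ⊤)

  -- max_s T(s) = t
  IsFloodingTime : Path → ℕ → Set
  IsFloodingTime ω t =
    (∀ s → ∃ λ u → u ℕ.< suc t × IsCompletionTime ω s u) × ∃ λ s → IsCompletionTime ω s t

  -- The flooding time is +∞, hence at least x, when no t satisfies IsFloodingTime ω t.
  FloodingTimeAtLeast : Carrier → Path → Set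
  FloodingTimeAtLeast x ω = ∀ t → IsFloodingTime ω t → x ≤ fromℕ t

  record CylinderEvent : Set₁ where
    field
      Event   : Path → Set
      event?  : ∀ ω → Dec (Event ω)
      horizon : ℕ
      local   : ∀ ω ω′ → (∀ t → t ℕ.≤ horizon → ω t ≡ ω′ t) → Event ω → Event ω′

  Prefix : ℕ → Set
  Prefix h = Vec Config (suc h)

  prefixes : ∀ h → List (Prefix h)
  prefixes h = allVecs (allVecs points n) (suc h)

  -- By `local`, how a prefix is continued does not matter.
  extend : ∀ {h} → Prefix h → Path
  extend (x ∷ [])     t       = x
  extend (x ∷ y ∷ ys) zero    = x
  extend (x ∷ y ∷ ys) (suc t) = extend (y ∷ ys) t

  stepsWeight : ∀ {h} → Point → Vec Point h → Carrier
  stepsWeight x []       = 1#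
  stepsWeight x (y ∷ ys) = step x y * stepsWeight y ys

  chainWeight : ∀ {h} → Vec Point (suc h) → Carrier
  chainWeight (x ∷ xs) = stationary x * stepsWeight x xs

  -- The nodes are independent copies of the stationary chain.
  weight : ∀ {h} → Prefix h → Carrier
  weight p = List.foldr _*_ 1# (List.map (λ i → chainWeight (Vec.map (λ c → lookup c i) p)) (allFin n))

  ℙ : CylinderEvent → Carrier
  ℙ E = List.foldr _+_ 0# (List.map (λ p → if does (event? (extend p)) then weight p else 0#) (prefixes horizon))
    where open CylinderEvent E

  _≟ˢ_ : (p q : Subset n) → Dec (p ≡ q)
  _≟ˢ_ = Vec.≡-dec Bool._≟_

  isCompletionTime? : ∀ ω s t → Dec (IsCompletionTime ω s t)
  isCompletionTime? ω s t =
    (informed ω s t ≟ˢ ⊤) ×-dec ℕ.allUpTo? (λ u → ¬? (informed ω s u ≟ˢ ⊤)) t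

  isFloodingTime? : ∀ ω t → Dec (IsFloodingTime ω t)
  isFloodingTime? ω t =
    Fin.all? (λ s → ℕ.anyUpTo? (isCompletionTime? ω s) (suc t)) ×-dec
    Fin.any? (λ s → isCompletionTime? ω s t)

  floodingTimeAtLeast? : ∀ x ω → Dec (FloodingTimeAtLeast x ω)
  floodingTimeAtLeast? x ω =
    map′ to (λ atLeast {t} _ → atLeast t)
      (ℕ.allUpTo? (λ t → isFloodingTime? ω t →-dec (x ≤? fromℕ t)) h)
    where
    h = proj₁ (archimedean x)
    to : (∀ {t} → t ℕ.< h → IsFloodingTime ω t → x ≤ fromℕ t) → FloodingTimeAtLeast x ω
    to below t isT with t ℕ.<? h
    ... | yes t<h = below t<h isT
    ... | no  t≮h = ≤-trans (proj₂ (archimedean x)) (fromℕ-mono (ℕ.≮⇒≥ t≮h))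

  N-cong : ∀ ω ω′ t I → ω t ≡ ω′ t → N ω t I ≡ N ω′ t I
  N-cong ω ω′ t I eq = ≡.cong (λ c → N (λ _ → c) t I) eq

  informed-local : ∀ ω ω′ h → (∀ t → t ℕ.≤ h → ω t ≡ ω′ t) →
                   ∀ s t → t ℕ.≤ h → informed ω s t ≡ informed ω′ s t
  informed-local ω ω′ h agree s zero    _   = ≡.refl
  informed-local ω ω′ h agree s (suc t) t<h =
    ≡.cong₂ _∪_ ih (≡.trans (N-cong ω ω′ t _ (agree t t≤h)) (≡.cong (N ω′ t) ih))
    where
    t≤h = ℕ.<⇒≤ t<h
    ih  = informed-local ω ω′ h agree s t t≤h

  completion-local : ∀ ω ω′ h → (∀ t → t ℕ.≤ h → ω t ≡ ω′ t) →
                     ∀ s t → t ℕ.≤ h → IsCompletionTime ω s t → IsCompletionTime ω′ s t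
  completion-local ω ω′ h agree s t t≤h (full , first) =
    ≡.trans (≡.sym (same t t≤h)) full ,
    λ {u} u<t full′ → first u<t (≡.trans (same u (ℕ.≤-trans (ℕ.<⇒≤ u<t) t≤h)) full′)
    where
    same = informed-local ω ω′ h agree s

  flooding-local : ∀ ω ω′ h → (∀ t → t ℕ.≤ h → ω t ≡ ω′ t) →
                   ∀ t → t ℕ.≤ h → IsFloodingTime ω t → IsFloodingTime ω′ t
  flooding-local ω ω′ h agree t t≤h (each , s , last) =
    (λ s′ → let u , u≤t , isT = each s′ in
            u , u≤t , completion-local ω ω′ h agree s′ u (ℕ.≤-trans (ℕ.≤-pred u≤t) t≤h) isT) ,
    s , completion-local ω ω′ h agree s t t≤h last

  atLeast-local : ∀ x ω ω′ → (∀ t → t ℕ.≤ proj₁ (archimedean x) → ω t ≡ ω′ t) →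
                  FloodingTimeAtLeast x ω → FloodingTimeAtLeast x ω′
  atLeast-local x ω ω′ agree atLeast t isT with ℕ.≤-total t (proj₁ (archimedean x))
  ... | inj₁ t≤h = atLeast t (flooding-local ω′ ω _ (λ u u≤h → ≡.sym (agree u u≤h)) t t≤h isT)
  ... | inj₂ h≤t = ≤-trans (proj₂ (archimedean x)) (fromℕ-mono h≤t)

  floodingTime≥ : Carrier → CylinderEvent
  floodingTime≥ x = record
    { Event   = FloodingTimeAtLeast x
    ; event?  = floodingTimeAtLeast? x
    ; horizon = proj₁ (archimedean x)
    ; local   = atLeast-local x
    }

{-# OPTIONS --safe #-}

-- Let X be the first coordinate.  On a path of positive probability a node
-- moves by at most r per step, and information reaches nodes at distance at
-- most R, so along X it spreads by at most R + r per step.  If at time 0 some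
-- node u is in the leftmost quarter of the columns and some node v in the
-- rightmost quarter, then v is at X-distance of order √n from u, and flooding
-- from u needs at least √n / (8 (R + r)) steps to reach v.
-- Each quarter has stationary probability at least 1/8: the weight of a column
-- is a sum Σ_i g(|m - i|) with g antitone, and two such sums over the same
-- range differ at most by a factor of 2.  By independence each quarter is thus
-- empty at time 0 with probability at most (7/8)^n ≤ 1/(2n).
module Submission where

open import Algebra.Bundles using (CommutativeMonoid; CommutativeRing; CommutativeSemiring)
import Algebra.Properties.CommutativeMonoid.Sum as FinSum
import Algebra.Properties.Ring as RingProperties
import Algebra.Properties.Semiring.Sum as SemiringSum
import Algebra.Solver.Ring.NaturalCoefficients.Default as SemiringSolver
open import Data.Bool.Base using (true; false; if_then_else_)
open import Data.Empty using (⊥-elim)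
open import Data.Fin.Base using (Fin; zero; suc; toℕ)
import Data.Fin.Properties as Fin
open import Data.Fin.Subset using (_∈_)
open import Data.Fin.Subset.Properties using (∈⊤; x∈⁅y⁆⇒x≡y; x∈p∪q⁻)
open import Data.List.Base as List using (List; []; _∷_; _++_; allFin; cartesianProductWith; filter; length)
open import Data.List.Membership.Propositional.Properties using (∈-allFin; ∈-cartesianProduct⁺; ∈-filter⁺; ∈-length)
import Data.List.Properties as List
open import Data.Nat.Base as ℕ using (ℕ; zero; suc; z≤n; s≤s; ∣_-_∣)
import Data.Nat.DivMod as ℕ
import Data.Nat.Properties as ℕ
import Data.Nat.Tactic.RingSolver as ℕ-Solver
open import Data.Product.Base using (∃; _×_; _,_; proj₁; proj₂)
open import Data.Sum.Base using (inj₁; inj₂)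
open import Data.Vec.Base as Vec using (Vec; []; _∷_; lookup; head)
import Data.Vec.Properties as Vec
open import Function.Base using (_∘_)
open import Function.Bundles using (mk⇔)
open import Relation.Binary.PropositionalEquality as ≡ using (_≡_)
import Relation.Binary.Reasoning.PartialOrder as PosetReasoning
import Relation.Binary.Reasoning.Setoid as SetoidReasoning
open import Relation.Nullary using (¬_; Dec; yes; no; does)
open import Relation.Nullary.Decidable using (dec-true; dec-false; does-⇔)
open import Relation.Unary using (Decidable)
open import Defs

-- Finite sums and products

module FoldrAllFin {c ℓ} (M : CommutativeMonoid c ℓ) where
  open CommutativeMonoid M
  open FinSum M

  foldr-tabulate : ∀ {n} (f : Fin n → Carrier) → List.foldr _∙_ ε (List.tabulate f) ≡ sum f
  foldr-tabulate {zero}  f = ≡.refl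
  foldr-tabulate {suc n} f = ≡.cong (f zero ∙_) (foldr-tabulate (f ∘ suc))

  foldr-allFin : ∀ {n} (f : Fin n → Carrier) → List.foldr _∙_ ε (List.map f (allFin n)) ≡ sum f
  foldr-allFin {n} f = ≡.trans (≡.cong (List.foldr _∙_ ε) (List.map-tabulate (λ i → i) f)) (foldr-tabulate f)

module ListSum {c ℓ} (S : CommutativeSemiring c ℓ) where
  open CommutativeSemiring S hiding (zero)
  open SetoidReasoning setoid
  open FinSum *-commutativeMonoid public using () renaming (sum to ∏; sum-cong-≋ to ∏-cong)

  ∑ : ∀ {a} {A : Set a} → List A → (A → Carrier) → Carrier
  ∑ xs f = List.foldr _+_ 0# (List.map f xs)

  module _ {a} {A : Set a} where

    ∑-cong : ∀ (xs : List A) {f g} → (∀ x → f x ≈ g x) → ∑ xs f ≈ ∑ xs g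
    ∑-cong []       eq = refl
    ∑-cong (x ∷ xs) eq = +-cong (eq x) (∑-cong xs eq)

    ∑-distrib-+ : ∀ (xs : List A) f g → ∑ xs (λ x → f x + g x) ≈ ∑ xs f + ∑ xs g
    ∑-distrib-+ []       f g = sym (+-identityˡ 0#)
    ∑-distrib-+ (x ∷ xs) f g = begin
      f x + g x + ∑ xs (λ x → f x + g x)  ≈⟨ +-congˡ (∑-distrib-+ xs f g) ⟩
      f x + g x + (∑ xs f + ∑ xs g)       ≈⟨ +-assoc _ _ _ ⟩
      f x + (g x + (∑ xs f + ∑ xs g))     ≈⟨ +-congˡ (+-assoc _ _ _) ⟨
      f x + (g x + ∑ xs f + ∑ xs g)       ≈⟨ +-congˡ (+-congʳ (+-comm _ _)) ⟩
      f x + (∑ xs f + g x + ∑ xs g)       ≈⟨ +-congˡ (+-assoc _ _ _) ⟩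
      f x + (∑ xs f + (g x + ∑ xs g))     ≈⟨ +-assoc _ _ _ ⟨
      f x + ∑ xs f + (g x + ∑ xs g)       ∎

    *-distribˡ-∑ : ∀ b (xs : List A) f → b * ∑ xs f ≈ ∑ xs (λ x → b * f x)
    *-distribˡ-∑ b []       f = zeroʳ b
    *-distribˡ-∑ b (x ∷ xs) f = trans (distribˡ b _ _) (+-congˡ (*-distribˡ-∑ b xs f))

    *-distribʳ-∑ : ∀ b (xs : List A) f → ∑ xs f * b ≈ ∑ xs (λ x → f x * b)
    *-distribʳ-∑ b []       f = zeroˡ b
    *-distribʳ-∑ b (x ∷ xs) f = trans (distribʳ b _ _) (+-congˡ (*-distribʳ-∑ b xs f))

    ∑-++ : ∀ (xs ys : List A) f → ∑ (xs ++ ys) f ≈ ∑ xs f + ∑ ys f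
    ∑-++ []       ys f = sym (+-identityˡ _)
    ∑-++ (x ∷ xs) ys f = trans (+-congˡ (∑-++ xs ys f)) (sym (+-assoc _ _ _))

    ∑-map : ∀ {b} {B : Set b} (h : B → A) xs f → ∑ (List.map h xs) f ≈ ∑ xs (f ∘ h)
    ∑-map h []       f = refl
    ∑-map h (x ∷ xs) f = +-congˡ (∑-map h xs f)

    ∑-cartesianProductWith : ∀ {b d} {B : Set b} {D : Set d} (h : B → D → A) xs ys f →
      ∑ (cartesianProductWith h xs ys) f ≈ ∑ xs (λ x → ∑ ys (λ y → f (h x y)))
    ∑-cartesianProductWith h []       ys f = refl
    ∑-cartesianProductWith h (x ∷ xs) ys f =
      trans (∑-++ (List.map (h x) ys) _ f)
            (+-cong (∑-map (h x) ys f) (∑-cartesianProductWith h xs ys f))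

  -- Independence of the nodes enters through this identity: a sum over all configurations of a
  -- product over nodes factors by distributivity, one coordinate at a time.
  ∑-allVecs-∏ : ∀ {A : Set} (xs : List A) {n} (g : Fin n → A → Carrier) →
    ∑ (allVecs xs n) (λ c → ∏ (λ i → g i (lookup c i))) ≈ ∏ (λ i → ∑ xs (g i))
  ∑-allVecs-∏ xs {zero}  g = +-identityʳ 1#
  ∑-allVecs-∏ xs {suc n} g = begin
    ∑ (cartesianProductWith _∷_ xs vs) (λ c → ∏ (λ i → g i (lookup c i)))
      ≈⟨ ∑-cartesianProductWith _∷_ xs vs _ ⟩
    ∑ xs (λ x → ∑ vs (λ c → g zero x * tail c))  ≈⟨ ∑-cong xs (λ x → *-distribˡ-∑ (g zero x) vs tail) ⟨
    ∑ xs (λ x → g zero x * ∑ vs tail)            ≈⟨ *-distribʳ-∑ (∑ vs tail) xs (g zero) ⟨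
    ∑ xs (g zero) * ∑ vs tail                    ≈⟨ *-congˡ (∑-allVecs-∏ xs (g ∘ suc)) ⟩
    ∑ xs (g zero) * ∏ (λ i → ∑ xs (g (suc i)))   ∎
    where
    vs = allVecs xs n
    tail : Vec _ n → Carrier
    tail c = ∏ (λ i → g (suc i) (lookup c i))

-- Sums and indicators over the natural numbers

module ℕ∑ = ListSum ℕ.+-*-commutativeSemiring
open SemiringSum ℕ.+-*-semiring using (sum; sum-cong-≗; *-distribˡ-sum)

∑-allFin : ∀ {n} (f : Fin n → ℕ) → ℕ∑.∑ (allFin n) f ≡ sum f
∑-allFin = FoldrAllFin.foldr-allFin ℕ.+-0-commutativeMonoid

does≡true⇒ : ∀ {p} {P : Set p} (P? : Dec P) → does P? ≡ true → P
does≡true⇒ (yes p) _ = p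

indicator : ∀ {p} {P : Set p} → Dec P → ℕ
indicator P? = if does P? then 1 else 0

indicator-yes : ∀ {p} {P : Set p} (P? : Dec P) → P → indicator P? ≡ 1
indicator-yes P? p = ≡.cong (λ b → if b then 1 else 0) (dec-true P? p)

indicator-no : ∀ {p} {P : Set p} (P? : Dec P) → ¬ P → indicator P? ≡ 0
indicator-no P? ¬p = ≡.cong (λ b → if b then 1 else 0) (dec-false P? ¬p)

indicator-mono : ∀ {p q} {P : Set p} {Q : Set q} (P? : Dec P) (Q? : Dec Q) → (P → Q) →
                 indicator P? ℕ.≤ indicator Q?
indicator-mono (no _)  Q?      P⇒Q = z≤n
indicator-mono (yes p) (yes _) P⇒Q = ℕ.≤-refl
indicator-mono (yes p) (no ¬q) P⇒Q with () ← ¬q (P⇒Q p)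

length-filter-∑ : ∀ {a p} {A : Set a} {P : A → Set p} (P? : Decidable P) xs →
                  length (filter P? xs) ≡ ℕ∑.∑ xs (λ x → indicator (P? x))
length-filter-∑ P? []       = ≡.refl
length-filter-∑ P? (x ∷ xs) with does (P? x)
... | true  = ≡.cong suc (length-filter-∑ P? xs)
... | false = length-filter-∑ P? xs

sum-mono : ∀ {n} {f g : Fin n → ℕ} → (∀ i → f i ℕ.≤ g i) → sum f ℕ.≤ sum g
sum-mono {zero}  f≤g = z≤n
sum-mono {suc n} f≤g = ℕ.+-mono-≤ (f≤g zero) (sum-mono (f≤g ∘ suc))

sum-const : ∀ n k → sum {n} (λ _ → k) ≡ n ℕ.* k
sum-const zero    k = ≡.refl
sum-const (suc n) k = ≡.cong (k ℕ.+_) (sum-const n k)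

sumBelow : ℕ → (ℕ → ℕ) → ℕ
sumBelow n f = sum {n} (f ∘ toℕ)

sumBelow-+ : ∀ a b f → sumBelow (a ℕ.+ b) f ≡ sumBelow a f ℕ.+ sumBelow b (λ i → f (a ℕ.+ i))
sumBelow-+ zero    b f = ≡.refl
sumBelow-+ (suc a) b f =
  ≡.trans (≡.cong (f 0 ℕ.+_) (sumBelow-+ a b (f ∘ suc))) (≡.sym (ℕ.+-assoc (f 0) _ _))

sumBelow-extend : ∀ a b f → sumBelow a f ℕ.≤ sumBelow (a ℕ.+ b) f
sumBelow-extend a b f = ℕ.≤-trans (ℕ.m≤m+n _ _) (ℕ.≤-reflexive (≡.sym (sumBelow-+ a b f)))

-- Antitone functions summed over distances

distanceSum : (ℕ → ℕ) → ℕ → ℕ → ℕ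
distanceSum g n m = sumBelow n (λ i → g ∣ m - i ∣)

module DistanceSum (g : ℕ → ℕ) (g-antitone : ∀ {d e} → d ℕ.≤ e → g e ℕ.≤ g d) where

  -- The distances from `m` to `0, …, m - 1` are `m, …, 1`; reversing the order of summation gives
  -- the shift by `suc`.
  sumBelow-reverse : ∀ m → sumBelow m (λ i → g ∣ m - i ∣) ≡ sumBelow m (g ∘ suc)
  sumBelow-reverse zero    = ≡.refl
  sumBelow-reverse (suc m) = begin
    g (suc m) ℕ.+ sumBelow m (λ i → g ∣ m - i ∣)       ≡⟨ ≡.cong (g (suc m) ℕ.+_) (sumBelow-reverse m) ⟩
    g (suc m) ℕ.+ sumBelow m (g ∘ suc)                 ≡⟨ ℕ.+-comm (g (suc m)) _ ⟩
    sumBelow m (g ∘ suc) ℕ.+ g (suc m)                 ≡⟨ ≡.cong (sumBelow m (g ∘ suc) ℕ.+_) last ⟩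
    sumBelow m (g ∘ suc) ℕ.+ sumBelow 1 (λ i → g (suc (m ℕ.+ i)))  ≡⟨ sumBelow-+ m 1 (g ∘ suc) ⟨
    sumBelow (m ℕ.+ 1) (g ∘ suc)                       ≡⟨ ≡.cong (λ k → sumBelow k (g ∘ suc)) (ℕ.+-comm m 1) ⟩
    sumBelow (suc m) (g ∘ suc)                         ∎
    where
    open ≡.≡-Reasoning
    last : g (suc m) ≡ sumBelow 1 (λ i → g (suc (m ℕ.+ i)))
    last = ≡.trans (≡.cong (g ∘ suc) (≡.sym (ℕ.+-identityʳ m))) (≡.sym (ℕ.+-identityʳ _))

  distanceSum-+ : ∀ m l → distanceSum g (m ℕ.+ l) m ≡ sumBelow m (g ∘ suc) ℕ.+ sumBelow l g
  distanceSum-+ m l = ≡.trans (sumBelow-+ m l (λ i → g ∣ m - i ∣))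
    (≡.cong₂ ℕ._+_ (sumBelow-reverse m) (sum-cong-≗ {l} (λ i → ≡.cong g (ℕ.∣m-m+n∣≡n m (toℕ i)))))

  -- Each side of `m` contributes at most the one-sided sum over the whole range, once the distances
  -- on the left are lowered by one.
  distanceSum-upper : ∀ m l → distanceSum g (m ℕ.+ l) m ℕ.≤ 2 ℕ.* sumBelow (m ℕ.+ l) g
  distanceSum-upper m l = begin
    distanceSum g (m ℕ.+ l) m                           ≡⟨ distanceSum-+ m l ⟩
    sumBelow m (g ∘ suc) ℕ.+ sumBelow l g             ≤⟨ ℕ.+-monoˡ-≤ _ (sum-mono {m} (λ i → g-antitone (ℕ.n≤1+n _))) ⟩
    sumBelow m g ℕ.+ sumBelow l g                     ≤⟨ ℕ.+-mono-≤ (sumBelow-extend m l g) (sumBelow-extend l m g) ⟩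
    sumBelow (m ℕ.+ l) g ℕ.+ sumBelow (l ℕ.+ m) g     ≡⟨ ≡.cong (λ k → sumBelow (m ℕ.+ l) g ℕ.+ sumBelow k g) (ℕ.+-comm l m) ⟩
    sumBelow (m ℕ.+ l) g ℕ.+ sumBelow (m ℕ.+ l) g     ≡⟨ ≡.cong (sumBelow (m ℕ.+ l) g ℕ.+_) (ℕ.+-identityʳ _) ⟨
    2 ℕ.* sumBelow (m ℕ.+ l) g                        ∎
    where open ℕ.≤-Reasoning

  -- The one-sided sum belongs to column 0 and is the smallest: moving the viewpoint to `m` replaces
  -- the `m` distances beyond `l` by the smaller distances `1, …, m` on the left, where `g` is at
  -- least as large.
  distanceSum-lower : ∀ m l → sumBelow (m ℕ.+ suc l) g ℕ.≤ distanceSum g (m ℕ.+ suc l) m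
  distanceSum-lower m l = begin
    sumBelow (m ℕ.+ suc l) g                                      ≡⟨ ≡.cong (λ k → sumBelow k g) (ℕ.+-comm m (suc l)) ⟩
    sumBelow (suc l ℕ.+ m) g                                      ≡⟨ sumBelow-+ (suc l) m g ⟩
    sumBelow (suc l) g ℕ.+ sumBelow m (λ i → g (suc l ℕ.+ i))     ≤⟨ ℕ.+-monoʳ-≤ (sumBelow (suc l) g) (sum-mono {m} (λ i → g-antitone (s≤s (ℕ.m≤n+m _ l)))) ⟩
    sumBelow (suc l) g ℕ.+ sumBelow m (g ∘ suc)                   ≡⟨ ℕ.+-comm (sumBelow (suc l) g) _ ⟩
    sumBelow m (g ∘ suc) ℕ.+ sumBelow (suc l) g                   ≡⟨ distanceSum-+ m (suc l) ⟨
    distanceSum g (m ℕ.+ suc l) m                                   ∎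
    where open ℕ.≤-Reasoning

  -- Both sides are compared with `sumBelow n g`, the sum seen from column 0.
  distanceSum-≤-double : ∀ {n m a} → m ℕ.< n → a ℕ.< n → distanceSum g n m ℕ.≤ 2 ℕ.* distanceSum g n a
  distanceSum-≤-double {n} {m} {a} m<n a<n
    with l , ≡.refl ← ℕ.m≤n⇒∃[o]m+o≡n (ℕ.<⇒≤ m<n) | k , eq ← ℕ.m≤n⇒∃[o]m+o≡n a<n =
    ℕ.≤-trans (distanceSum-upper m l) (ℕ.*-monoʳ-≤ 2
      (≡.subst (λ n → sumBelow n g ℕ.≤ distanceSum g n a) (≡.trans (ℕ.+-suc a k) eq) (distanceSum-lower a k)))

-- Weight of a block of consecutive columns

module Blocks (W : ℕ → ℕ) (n : ℕ) (W-≤-double : ∀ {m a} → m ℕ.< n → a ℕ.< n → W m ℕ.≤ 2 ℕ.* W a) where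

  -- A column weighs at most twice the average over the block, and the range has at most four times
  -- as many columns as the block; hence the factor 8. Scaling by `suc a` keeps the averaging free
  -- of division.
  block-large : ∀ o a → suc a ℕ.+ o ℕ.≤ n → n ℕ.≤ 4 ℕ.* suc a →
                sumBelow n W ℕ.≤ 8 ℕ.* sumBelow (suc a) (λ i → W (o ℕ.+ i))
  block-large o a fits n≤4a = ℕ.*-cancelˡ-≤ (suc a) (begin
    suc a ℕ.* sumBelow n W               ≡⟨ *-distribˡ-sum {n} (suc a) (W ∘ toℕ) ⟩
    sum {n} (λ m → suc a ℕ.* W (toℕ m))  ≤⟨ sum-mono {n} (λ m → column (Fin.toℕ<n m)) ⟩
    sum {n} (λ _ → 2 ℕ.* M)              ≡⟨ sum-const n (2 ℕ.* M) ⟩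
    n ℕ.* (2 ℕ.* M)                      ≤⟨ ℕ.*-monoˡ-≤ (2 ℕ.* M) n≤4a ⟩
    4 ℕ.* suc a ℕ.* (2 ℕ.* M)            ≡⟨ rearrange (suc a) M ⟩
    suc a ℕ.* (8 ℕ.* M)                  ∎)
    where
    open ℕ.≤-Reasoning
    M = sumBelow (suc a) (λ i → W (o ℕ.+ i))
    rearrange : ∀ x y → 4 ℕ.* x ℕ.* (2 ℕ.* y) ≡ x ℕ.* (8 ℕ.* y)
    rearrange = ℕ-Solver.solve-∀
    column : ∀ {m} → m ℕ.< n → suc a ℕ.* W m ℕ.≤ 2 ℕ.* M
    column {m} m<n = begin
      suc a ℕ.* W m                                   ≡⟨ sum-const (suc a) (W m) ⟨
      sum {suc a} (λ _ → W m)                         ≤⟨ sum-mono {suc a} (λ i → W-≤-double m<n (inside i)) ⟩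
      sum {suc a} (λ i → 2 ℕ.* W (o ℕ.+ toℕ i))       ≡⟨ *-distribˡ-sum {suc a} 2 (λ i → W (o ℕ.+ toℕ i)) ⟨
      2 ℕ.* M                                         ∎
      where
      inside : (i : Fin (suc a)) → o ℕ.+ toℕ i ℕ.< n
      inside i = ℕ.<-≤-trans (ℕ.+-monoʳ-< o (Fin.toℕ<n i)) (ℕ.≤-trans (ℕ.≤-reflexive (ℕ.+-comm o (suc a))) fits)

-- If a block has at least 1/8 of the total, its complement has at most 7/8. Adding `8 * M` on both
-- sides avoids truncated subtraction.
complement-small : ∀ M rest → rest ℕ.+ M ℕ.≤ 8 ℕ.* M → 8 ℕ.* rest ℕ.≤ 7 ℕ.* (rest ℕ.+ M)
complement-small M rest le = ℕ.+-cancelʳ-≤ (8 ℕ.* M) _ _ (begin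
  8 ℕ.* rest ℕ.+ 8 ℕ.* M                  ≡⟨ ℕ.*-distribˡ-+ 8 rest M ⟨
  8 ℕ.* (rest ℕ.+ M)                      ≡⟨ ℕ.+-comm (rest ℕ.+ M) _ ⟩
  7 ℕ.* (rest ℕ.+ M) ℕ.+ (rest ℕ.+ M)     ≤⟨ ℕ.+-monoʳ-≤ (7 ℕ.* (rest ℕ.+ M)) le ⟩
  7 ℕ.* (rest ℕ.+ M) ℕ.+ 8 ℕ.* M          ∎)
  where open ℕ.≤-Reasoning

sumBelow-indicator-≥ : ∀ a b (f : ℕ → ℕ) → sumBelow (a ℕ.+ b) (λ i → indicator (a ℕ.≤? i) ℕ.* f i) ≡ sumBelow b (λ i → f (a ℕ.+ i))
sumBelow-indicator-≥ a b f = begin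
  sumBelow (a ℕ.+ b) (λ i → indicator (a ℕ.≤? i) ℕ.* f i)  ≡⟨ sumBelow-+ a b (λ i → indicator (a ℕ.≤? i) ℕ.* f i) ⟩
  sumBelow a (λ i → indicator (a ℕ.≤? i) ℕ.* f i) ℕ.+ sumBelow b (λ i → indicator (a ℕ.≤? (a ℕ.+ i)) ℕ.* f (a ℕ.+ i))
    ≡⟨ ≡.cong₂ ℕ._+_ (≡.trans (sum-cong-≗ {a} below) (≡.trans (sum-const a 0) (ℕ.*-zeroʳ a))) (sum-cong-≗ {b} above) ⟩
  sumBelow b (λ i → f (a ℕ.+ i))  ∎
  where
  open ≡.≡-Reasoning
  below : (i : Fin a) → indicator (a ℕ.≤? toℕ i) ℕ.* f (toℕ i) ≡ 0
  below i = ≡.cong (ℕ._* f (toℕ i)) (indicator-no (a ℕ.≤? toℕ i) (ℕ.<⇒≱ (Fin.toℕ<n i)))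
  above : (i : Fin b) → indicator (a ℕ.≤? (a ℕ.+ toℕ i)) ℕ.* f (a ℕ.+ toℕ i) ≡ f (a ℕ.+ toℕ i)
  above i = ≡.trans (≡.cong (ℕ._* f (a ℕ.+ toℕ i)) (indicator-yes (a ℕ.≤? (a ℕ.+ toℕ i)) (ℕ.m≤m+n a _)))
                    (ℕ.*-identityˡ _)

sumBelow-indicator-< : ∀ a b (f : ℕ → ℕ) → sumBelow (a ℕ.+ b) (λ i → indicator (i ℕ.<? a) ℕ.* f i) ≡ sumBelow a f
sumBelow-indicator-< a b f = begin
  sumBelow (a ℕ.+ b) (λ i → indicator (i ℕ.<? a) ℕ.* f i)  ≡⟨ sumBelow-+ a b (λ i → indicator (i ℕ.<? a) ℕ.* f i) ⟩
  sumBelow a (λ i → indicator (i ℕ.<? a) ℕ.* f i) ℕ.+ sumBelow b (λ i → indicator ((a ℕ.+ i) ℕ.<? a) ℕ.* f (a ℕ.+ i))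
    ≡⟨ ≡.cong₂ ℕ._+_ (sum-cong-≗ {a} below) (≡.trans (sum-cong-≗ {b} above) (≡.trans (sum-const b 0) (ℕ.*-zeroʳ b))) ⟩
  sumBelow a f ℕ.+ 0  ≡⟨ ℕ.+-identityʳ _ ⟩
  sumBelow a f        ∎
  where
  open ≡.≡-Reasoning
  below : (i : Fin a) → indicator (toℕ i ℕ.<? a) ℕ.* f (toℕ i) ≡ f (toℕ i)
  below i = ≡.trans (≡.cong (ℕ._* f (toℕ i)) (indicator-yes (toℕ i ℕ.<? a) (Fin.toℕ<n i)))
                    (ℕ.*-identityˡ _)
  above : (i : Fin b) → indicator ((a ℕ.+ toℕ i) ℕ.<? a) ℕ.* f (a ℕ.+ toℕ i) ≡ 0
  above i = ≡.cong (ℕ._* f (a ℕ.+ toℕ i)) (indicator-no ((a ℕ.+ toℕ i) ℕ.<? a) (ℕ.≤⇒≯ (ℕ.m≤m+n a _)))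

-- Comparing 2n(7/8)^n with 1

eventually-2n7ⁿ≤8ⁿ : ∀ n₀ → 7 ℕ.≤ n₀ → 2 ℕ.* n₀ ℕ.* 7 ℕ.^ n₀ ℕ.≤ 8 ℕ.^ n₀ →
                     ∀ {n} → n₀ ℕ.≤′ n → 2 ℕ.* n ℕ.* 7 ℕ.^ n ℕ.≤ 8 ℕ.^ n
eventually-2n7ⁿ≤8ⁿ n₀ 7≤n₀ base ℕ.≤′-refl                = base
eventually-2n7ⁿ≤8ⁿ n₀ 7≤n₀ base (ℕ.≤′-step {n = m} n₀≤m) = begin
  2 ℕ.* suc m ℕ.* (7 ℕ.* 7 ℕ.^ m)     ≡⟨ split m (7 ℕ.^ m) ⟩
  -- The left side grows by the factor 7(m + 1)/m, which is at most 8 once m is at least 7.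
  (14 ℕ.* m ℕ.+ 14) ℕ.* 7 ℕ.^ m       ≤⟨ ℕ.*-monoˡ-≤ (7 ℕ.^ m) (ℕ.+-monoʳ-≤ (14 ℕ.* m) 14≤2m) ⟩
  (14 ℕ.* m ℕ.+ 2 ℕ.* m) ℕ.* 7 ℕ.^ m  ≡⟨ join m (7 ℕ.^ m) ⟩
  8 ℕ.* (2 ℕ.* m ℕ.* 7 ℕ.^ m)         ≤⟨ ℕ.*-monoʳ-≤ 8 (eventually-2n7ⁿ≤8ⁿ n₀ 7≤n₀ base n₀≤m) ⟩
  8 ℕ.* 8 ℕ.^ m                       ∎
  where
  open ℕ.≤-Reasoning
  14≤2m : 14 ℕ.≤ 2 ℕ.* m
  14≤2m = ℕ.*-monoʳ-≤ 2 (ℕ.≤-trans 7≤n₀ (ℕ.≤′⇒≤ n₀≤m))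
  split : ∀ m p → 2 ℕ.* suc m ℕ.* (7 ℕ.* p) ≡ (14 ℕ.* m ℕ.+ 14) ℕ.* p
  split = ℕ-Solver.solve-∀
  join : ∀ m p → (14 ℕ.* m ℕ.+ 2 ℕ.* m) ℕ.* p ≡ 8 ℕ.* (2 ℕ.* m ℕ.* p)
  join = ℕ-Solver.solve-∀

2n7ⁿ≤8ⁿ : ∀ {n} → 40 ℕ.≤ n → 2 ℕ.* n ℕ.* 7 ℕ.^ n ℕ.≤ 8 ℕ.^ n
-- The base case 40 is settled by evaluating the Boolean comparison.
2n7ⁿ≤8ⁿ 40≤n = eventually-2n7ⁿ≤8ⁿ 40 (ℕ.≤ᵇ⇒≤ 7 40 _) (ℕ.≤ᵇ⇒≤ (2 ℕ.* 40 ℕ.* 7 ℕ.^ 40) (8 ℕ.^ 40) _) (ℕ.≤⇒≤′ 40≤n)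

-- Ordered-field arithmetic

module RealProperties (𝓡 : CompleteOrderedField) where
  open CompleteOrderedField 𝓡
  open RealFunctions 𝓡
  open CommutativeRing commutativeRing
    using (ring; commutativeSemiring; +-comm; +-cong; +-congˡ; +-congʳ; +-assoc; +-identityˡ; +-identityʳ;
           *-comm; *-cong; *-congˡ; *-congʳ; *-assoc; *-identityˡ; *-identityʳ; distribˡ; distribʳ; zeroˡ; zeroʳ; -‿inverseʳ)
    renaming (refl to ≈-refl; sym to ≈-sym; trans to ≈-trans; reflexive to ≈-reflexive)
  open RingProperties ring using (-‿+-comm; -‿involutive)
  open SemiringSolver commutativeSemiring using (solve; _:=_; _:+_; _:*_)
  open PosetReasoning poset
  open ListSum commutativeSemiring using (∑; ∏)

  *-monoʳ-≤ : ∀ {z x y} → 0# ≤ z → x ≤ y → x * z ≤ y * z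
  *-monoʳ-≤ {z} {x} {y} 0≤z x≤y = begin
    x * z  ≈⟨ *-comm x z ⟩
    z * x  ≤⟨ *-monoˡ-≤ 0≤z x≤y ⟩
    z * y  ≈⟨ *-comm z y ⟩
    y * z  ∎

  +-mono-≤ : ∀ {u v x y} → u ≤ v → x ≤ y → u + x ≤ v + y
  +-mono-≤ u≤v x≤y = ≤-trans (+-monoˡ-≤ _ u≤v) (+-monoʳ-≤ _ x≤y)

  x-y≤z⇒x≤y+z : ∀ {x y z} → x - y ≤ z → x ≤ y + z
  x-y≤z⇒x≤y+z {x} {y} x-y≤z = ≤-trans (≤-reflexive (≈-sym (x+[y-x]≈y y x))) (+-monoʳ-≤ y x-y≤z)

  x≤y+z⇒x-z≤y : ∀ {x y z} → x ≤ y + z → x - z ≤ y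
  x≤y+z⇒x-z≤y {x} {y} {z} x≤y+z = +-cancelʳ-≤ z (begin
    x - z + z    ≈⟨ +-comm _ z ⟩
    z + (x - z)  ≈⟨ x+[y-x]≈y z x ⟩
    x            ≤⟨ x≤y+z ⟩
    y + z        ∎)

  *-cancelˡ-≤ : ∀ {z x y} → 0# ≤ z → ¬ (z ≈ 0#) → z * x ≤ z * y → x ≤ y
  *-cancelˡ-≤ {z} {x} {y} 0≤z z≉0 zx≤zy = begin
    x               ≈⟨ undo x ⟨
    z ⁻¹ * (z * x)  ≤⟨ *-monoˡ-≤ (⁻¹-nonneg 0≤z z≉0) zx≤zy ⟩
    z ⁻¹ * (z * y)  ≈⟨ undo y ⟩
    y               ∎
    where
    undo : ∀ w → z ⁻¹ * (z * w) ≈ w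
    undo w = ≈-trans (≈-sym (*-assoc _ z w))
      (≈-trans (*-congʳ (≈-trans (*-comm _ z) (*-inverseʳ z z≉0))) (*-identityˡ w))

  z*[x/z]≈x : ∀ {x z} → ¬ (z ≈ 0#) → z * (x / z) ≈ x
  z*[x/z]≈x {x} {z} z≉0 = ≈-trans
    (solve 3 (λ z x i → z :* (x :* i) := (z :* i) :* x) ≈-refl z x (z ⁻¹))
    (≈-trans (*-congʳ (*-inverseʳ z z≉0)) (*-identityˡ x))

  x≤z*y⇒x/z≤y : ∀ {x y z} → 0# ≤ z → ¬ (z ≈ 0#) → x ≤ z * y → x / z ≤ y
  x≤z*y⇒x/z≤y 0≤z z≉0 x≤zy = *-cancelˡ-≤ 0≤z z≉0 (≤-trans (≤-reflexive (z*[x/z]≈x z≉0)) x≤zy)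

  -- The sign of `x` is free, so the lemma applies to signed coordinate differences. If `y ≤ x` and
  -- `x` is nonzero, then `x * x ≤ y * y ≤ x * y`, and `x` cancels.
  square-cancel-≤ : ∀ {x y} → 0# ≤ y → x * x ≤ y * y → x ≤ y
  square-cancel-≤ {x} {y} 0≤y xx≤yy with total x y | x ≟ 0#
  ... | inj₁ x≤y | _       = x≤y
  ... | inj₂ y≤x | yes x≈0 = ≤-trans (≤-reflexive x≈0) 0≤y
  ... | inj₂ y≤x | no  x≉0 = *-cancelˡ-≤ (≤-trans 0≤y y≤x) x≉0 (≤-trans xx≤yy (*-monoʳ-≤ 0≤y y≤x))

  square-mono-≤ : ∀ {x y} → 0# ≤ x → x ≤ y → x * x ≤ y * y
  square-mono-≤ 0≤x x≤y = ≤-trans (*-monoˡ-≤ 0≤x x≤y) (*-monoʳ-≤ (≤-trans 0≤x x≤y) x≤y)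

  √x≤y⇒x≤y² : ∀ {x y} → 0# ≤ x → √ x ≤ y → x ≤ y * y
  √x≤y⇒x≤y² 0≤x √x≤y =
    ≤-trans (≤-reflexive (≈-sym (proj₂ (√-spec 0≤x)))) (square-mono-≤ (proj₁ (√-spec 0≤x)) √x≤y)

  x≤y²⇒√x≤y : ∀ {x y} → 0# ≤ x → 0# ≤ y → x ≤ y * y → √ x ≤ y
  x≤y²⇒√x≤y 0≤x 0≤y x≤yy = square-cancel-≤ 0≤y (≤-trans (≤-reflexive (proj₂ (√-spec 0≤x))) x≤yy)

  [y-x]²≈[x-y]² : ∀ x y → (y - x) * (y - x) ≈ (x - y) * (x - y)
  [y-x]²≈[x-y]² x y = ≈-trans (≈-sym (-x*-x≈x*x (y - x))) (*-cong neg neg)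
    where
    neg : - (y - x) ≈ x - y
    neg = ≈-trans (≈-sym (-‿+-comm y (- x))) (≈-trans (+-congˡ (-‿involutive x)) (+-comm _ x))

  fromℕ-nonneg : ∀ k → 0# ≤ fromℕ k
  fromℕ-nonneg k = fromℕ-mono {k = k} z≤n

  fromℕ-≉0 : ∀ {k} → 1 ℕ.≤ k → ¬ (fromℕ k ≈ 0#)
  fromℕ-≉0 {k} 1≤k eq = 1≰0 (begin
    1#       ≈⟨ +-identityʳ 1# ⟨
    1# + 0#  ≤⟨ fromℕ-mono 1≤k ⟩
    fromℕ k  ≈⟨ eq ⟩
    0#       ∎)

  fromℕ-+ : ∀ j k → fromℕ (j ℕ.+ k) ≈ fromℕ j + fromℕ k
  fromℕ-+ zero    k = ≈-sym (+-identityˡ _)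
  fromℕ-+ (suc j) k = ≈-trans (+-congˡ (fromℕ-+ j k)) (≈-sym (+-assoc _ _ _))

  fromℕ-* : ∀ j k → fromℕ (j ℕ.* k) ≈ fromℕ j * fromℕ k
  fromℕ-* zero    k = ≈-sym (zeroˡ _)
  fromℕ-* (suc j) k = begin-equality
    fromℕ (k ℕ.+ j ℕ.* k)              ≈⟨ fromℕ-+ k (j ℕ.* k) ⟩
    fromℕ k + fromℕ (j ℕ.* k)          ≈⟨ +-cong (≈-sym (*-identityˡ _)) (fromℕ-* j k) ⟩
    1# * fromℕ k + fromℕ j * fromℕ k   ≈⟨ distribʳ _ _ _ ⟨
    (1# + fromℕ j) * fromℕ k           ∎

  fromℕ-1 : fromℕ 1 ≈ 1#
  fromℕ-1 = +-identityʳ 1#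

  fromℕ-2-* : ∀ x → fromℕ 2 * x ≈ x + x
  fromℕ-2-* x = ≈-trans (*-congʳ (+-congˡ fromℕ-1)) (≈-trans (distribʳ _ _ _) (+-cong (*-identityˡ x) (*-identityˡ x)))

  fromℕ-∑ : ∀ {A : Set} (xs : List A) f → fromℕ (ℕ∑.∑ xs f) ≈ ∑ xs (fromℕ ∘ f)
  fromℕ-∑ []       f = ≈-refl
  fromℕ-∑ (x ∷ xs) f = ≈-trans (fromℕ-+ (f x) _) (+-congˡ (fromℕ-∑ xs f))

  [i+d]ε-iε : ∀ ε i d → fromℕ (i ℕ.+ d) * ε - fromℕ i * ε ≈ fromℕ d * ε
  [i+d]ε-iε ε i d = begin-equality
    fromℕ (i ℕ.+ d) * ε - fromℕ i * ε            ≈⟨ +-congʳ (*-congʳ (fromℕ-+ i d)) ⟩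
    (fromℕ i + fromℕ d) * ε - fromℕ i * ε        ≈⟨ +-congʳ (≈-trans (distribʳ _ _ _) (+-comm _ _)) ⟩
    fromℕ d * ε + fromℕ i * ε - fromℕ i * ε      ≈⟨ +-assoc _ _ _ ⟩
    fromℕ d * ε + (fromℕ i * ε - fromℕ i * ε)    ≈⟨ +-congˡ (-‿inverseʳ _) ⟩
    fromℕ d * ε + 0#                             ≈⟨ +-identityʳ _ ⟩
    fromℕ d * ε                                  ∎

  -- Makes the horizontal part of a squared distance a function of the natural number `∣ i - j ∣`,
  -- the form that `distanceSum` requires.
  [iε-jε]²≈[∣i-j∣ε]² : ∀ ε i j → (fromℕ i * ε - fromℕ j * ε) * (fromℕ i * ε - fromℕ j * ε) ≈
                                 (fromℕ ∣ i - j ∣ * ε) * (fromℕ ∣ i - j ∣ * ε)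
  [iε-jε]²≈[∣i-j∣ε]² ε i j with ℕ.≤-total i j
  ... | inj₁ i≤j with d , ≡.refl ← ℕ.m≤n⇒∃[o]m+o≡n i≤j rewrite ℕ.∣m-m+n∣≡n i d =
    ≈-trans ([y-x]²≈[x-y]² _ _) (*-cong ([i+d]ε-iε ε i d) ([i+d]ε-iε ε i d))
  [iε-jε]²≈[∣i-j∣ε]² ε i j | inj₂ j≤i with d , ≡.refl ← ℕ.m≤n⇒∃[o]m+o≡n j≤i
    rewrite ℕ.∣-∣-comm (j ℕ.+ d) j | ℕ.∣m-m+n∣≡n j d = *-cong ([i+d]ε-iε ε j d) ([i+d]ε-iε ε j d)

  -- The union bound for a single path: where `A` fails, the error term `e` covers the weight `w`.
  if-does-bound : ∀ {A : Set} (A? : Dec A) {w e} → 0# ≤ e → (¬ A → w ≤ e) → w ≤ (if does A? then w else 0#) + e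
  if-does-bound (yes _) 0≤e _    = x≤x+y _ 0≤e
  if-does-bound (no ¬a) 0≤e w≤e = ≤-trans (w≤e ¬a) (≤-reflexive (≈-sym (+-identityˡ _)))

  ∑-mono : ∀ {A : Set} (xs : List A) {f g} → (∀ x → f x ≤ g x) → ∑ xs f ≤ ∑ xs g
  ∑-mono []       f≤g = ≤-refl
  ∑-mono (x ∷ xs) f≤g = +-mono-≤ (f≤g x) (∑-mono xs f≤g)

  ∏-nonneg : ∀ {n} {f : Fin n → Carrier} → (∀ i → 0# ≤ f i) → 0# ≤ ∏ f
  ∏-nonneg {zero}  0≤f = 0≤1
  ∏-nonneg {suc n} 0≤f = *-nonneg (0≤f zero) (∏-nonneg (0≤f ∘ suc))

  ∏-≉0 : ∀ {n} {f : Fin n → Carrier} → ¬ (∏ f ≈ 0#) → ∀ i → ¬ (f i ≈ 0#)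
  ∏-≉0 {suc n} ≉0 zero    eq = ≉0 (≈-trans (*-congʳ eq) (zeroˡ _))
  ∏-≉0 {suc n} ≉0 (suc i) eq = ∏-≉0 (λ eq′ → ≉0 (≈-trans (*-congˡ eq′) (zeroʳ _))) i eq

  ∏-one : ∀ n → ∏ {n} (λ _ → 1#) ≈ 1#
  ∏-one zero    = ≈-refl
  ∏-one (suc n) = ≈-trans (*-identityˡ _) (∏-one n)

  -- The division-free form of passing from `y ≤ b / a` to the n-th powers.
  ∏-const-bound : ∀ {y a b} n → 0# ≤ y → fromℕ a * y ≤ fromℕ b → fromℕ (a ℕ.^ n) * ∏ {n} (λ _ → y) ≤ fromℕ (b ℕ.^ n)
  ∏-const-bound zero _ _ = ≤-reflexive (*-identityʳ _)
  ∏-const-bound {y} {a} {b} (suc n) 0≤y ay≤b = begin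
    fromℕ (a ℕ.* a ℕ.^ n) * (y * p)            ≈⟨ *-congʳ (fromℕ-* a (a ℕ.^ n)) ⟩
    fromℕ a * fromℕ (a ℕ.^ n) * (y * p)        ≈⟨ solve 4 (λ a b y p → a :* b :* (y :* p) := a :* y :* (b :* p)) ≈-refl _ _ _ _ ⟩
    fromℕ a * y * (fromℕ (a ℕ.^ n) * p)        ≤⟨ *-monoˡ-≤ (*-nonneg (fromℕ-nonneg a) 0≤y) (∏-const-bound n 0≤y ay≤b) ⟩
    fromℕ a * y * fromℕ (b ℕ.^ n)              ≤⟨ *-monoʳ-≤ (fromℕ-nonneg (b ℕ.^ n)) ay≤b ⟩
    fromℕ b * fromℕ (b ℕ.^ n)                  ≈⟨ fromℕ-* b (b ℕ.^ n) ⟨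
    fromℕ (b ℕ.* b ℕ.^ n)                      ∎
    where p = ∏ {n} (λ _ → y)

  ∏-const-small : ∀ {y n} → 40 ℕ.≤ n → 0# ≤ y → fromℕ 8 * y ≤ fromℕ 7 → fromℕ (2 ℕ.* n) * ∏ {n} (λ _ → y) ≤ 1#
  ∏-const-small {y} {n} 40≤n 0≤y 8y≤7 = *-cancelˡ-≤ (fromℕ-nonneg (8 ℕ.^ n)) (fromℕ-≉0 (ℕ.m^n>0 8 n)) (begin
    fromℕ (8 ℕ.^ n) * (fromℕ (2 ℕ.* n) * p)    ≈⟨ solve 3 (λ a b p → a :* (b :* p) := b :* (a :* p)) ≈-refl _ _ p ⟩
    fromℕ (2 ℕ.* n) * (fromℕ (8 ℕ.^ n) * p)    ≤⟨ *-monoˡ-≤ (fromℕ-nonneg (2 ℕ.* n)) (∏-const-bound n 0≤y 8y≤7) ⟩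
    fromℕ (2 ℕ.* n) * fromℕ (7 ℕ.^ n)          ≈⟨ fromℕ-* (2 ℕ.* n) (7 ℕ.^ n) ⟨
    fromℕ (2 ℕ.* n ℕ.* 7 ℕ.^ n)                ≤⟨ fromℕ-mono (2n7ⁿ≤8ⁿ 40≤n) ⟩
    fromℕ (8 ℕ.^ n)                            ≈⟨ *-identityʳ _ ⟨
    fromℕ (8 ℕ.^ n) * 1#                       ∎)
    where p = ∏ {n} (λ _ → y)

-- The geometric-MEG

module FloodingLowerBound (𝓡 : CompleteOrderedField) (n : ℕ) (r R ε : CompleteOrderedField.Carrier 𝓡)
  (0≤r : CompleteOrderedField._≤_ 𝓡 (CompleteOrderedField.0# 𝓡) r)
  (0<ε : CompleteOrderedField._<_ 𝓡 (CompleteOrderedField.0# 𝓡) ε)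
  (ε≤1 : CompleteOrderedField._≤_ 𝓡 ε (CompleteOrderedField.1# 𝓡))
  (ε<R : CompleteOrderedField._<_ 𝓡 ε R)
  (40≤n : 40 ℕ.≤ n) where
  open CompleteOrderedField 𝓡
  open RealFunctions 𝓡
  open RealProperties 𝓡
  open CommutativeRing commutativeRing
    using (commutativeSemiring; +-comm; +-cong; +-congˡ; +-congʳ; +-assoc; +-identityˡ; +-identityʳ;
           *-comm; *-cong; *-congˡ; *-congʳ; *-assoc; *-identityˡ; *-identityʳ; distribˡ; distribʳ; zeroˡ; zeroʳ; -‿inverseʳ)
    renaming (refl to ≈-refl; sym to ≈-sym; trans to ≈-trans; reflexive to ≈-reflexive)
  open SemiringSolver commutativeSemiring using (solve; _:=_; _:+_; _:*_)
  open PosetReasoning poset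
  open ListSum commutativeSemiring
  open GeometricMEG 𝓡 n r R ε

  -- A consists of the first a of the suc K columns, B of the last a (those ≥ b).
  K q a b : ℕ
  K = ⌊ √ fromℕ n / ε ⌋
  q = K ℕ./ 4
  a = suc q
  b = K ℕ.∸ q

  -- The rounding of `q` has to serve two purposes: `4q≤K` keeps the two quarters far apart, and
  -- `1+K≤4a` keeps each of them heavy.
  4q≤K : 4 ℕ.* q ℕ.≤ K
  4q≤K = ℕ.≤-trans (ℕ.≤-reflexive (ℕ.*-comm 4 q)) (ℕ.m/n*n≤m K 4)

  q≤K : q ℕ.≤ K
  q≤K = ℕ.m/n≤m K 4

  a+b≡1+K : a ℕ.+ b ≡ suc K
  a+b≡1+K = ≡.cong suc (ℕ.m+[n∸m]≡n q≤K)

  1+K≤4a : suc K ℕ.≤ 4 ℕ.* a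
  1+K≤4a = ℕ.≤-trans (ℕ.≤-reflexive (≡.cong suc (ℕ.m≡m%n+[m/n]*n K 4)))
    (ℕ.≤-trans (ℕ.+-monoˡ-≤ (q ℕ.* 4) (ℕ.m%n<n K 4)) (ℕ.≤-reflexive (ℕ.*-comm a 4)))

  0≤ε : 0# ≤ ε
  0≤ε = proj₁ 0<ε

  ε≉0 : ¬ (ε ≈ 0#)
  ε≉0 eq = proj₂ 0<ε (≈-sym eq)

  0≤R : 0# ≤ R
  0≤R = ≤-trans 0≤ε (proj₁ ε<R)

  0≤R+r : 0# ≤ R + r
  0≤R+r = +-nonneg 0≤R 0≤r

  R+r≉0 : ¬ (R + r ≈ 0#)
  R+r≉0 eq = ε≉0 (antisym (≤-trans (proj₁ ε<R) (≤-trans (x≤x+y R 0≤r) (≤-reflexive eq))) 0≤ε)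

  -- The horizontal coordinate

  column : Point → ℕ
  column x = toℕ (proj₁ x)

  X : Point → Carrier
  X x = fromℕ (column x) * ε

  Close : Carrier → Point → Point → Set
  Close d x y = X x ≤ X y + d × X y ≤ X x + d

  Δ : Fin (suc K) → Fin (suc K) → Carrier
  Δ i j = fromℕ (toℕ i) * ε - fromℕ (toℕ j) * ε

  0≤Δ²+Δ² : ∀ i i′ j j′ → 0# ≤ Δ i i′ * Δ i i′ + Δ j j′ * Δ j j′
  0≤Δ²+Δ² i i′ j j′ = +-nonneg (0≤x*x _) (0≤x*x _)

  -- Dropping the vertical square leaves the square of the horizontal difference, bounded by
  -- `d * d`; both signs of the difference are then handled by `square-cancel-≤`.
  dist≤⇒Close : ∀ {d} x y → 0# ≤ d → dist x y ≤ d → Close d x y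
  dist≤⇒Close {d} (i , j) (i′ , j′) 0≤d dist≤d =
    x-y≤z⇒x≤y+z (square-cancel-≤ 0≤d Δ²≤d²) ,
    x-y≤z⇒x≤y+z (square-cancel-≤ 0≤d (≤-trans (≤-reflexive ([y-x]²≈[x-y]² _ _)) Δ²≤d²))
    where
    Δ²≤d² : Δ i i′ * Δ i i′ ≤ d * d
    Δ²≤d² = ≤-trans (x≤x+y _ (0≤x*x _)) (√x≤y⇒x≤y² (0≤Δ²+Δ² i i′ j j′) dist≤d)

  -- The size of Γ, column by column

  Near : Fin (suc K) → ℕ → Fin (suc K) → Set
  Near j d j′ = (fromℕ d * ε) * (fromℕ d * ε) + Δ j j′ * Δ j j′ ≤ r * r

  near? : ∀ j d j′ → Dec (Near j d j′)
  near? j d j′ = _ ≤? _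

  columnCount : Fin (suc K) → ℕ → ℕ
  columnCount j d = sum (λ j′ → indicator (near? j d j′))

  columnCount-antitone : ∀ j {d e} → d ℕ.≤ e → columnCount j e ℕ.≤ columnCount j d
  columnCount-antitone j {d} {e} d≤e = sum-mono (λ j′ → indicator-mono (near? j e j′) (near? j d j′)
    (≤-trans (+-monoˡ-≤ _ (square-mono-≤ (*-nonneg (fromℕ-nonneg d) 0≤ε) (*-monoʳ-≤ 0≤ε (fromℕ-mono d≤e))))))

  -- `Near` is the squared form of `dist ≤ r`. It sees the two columns only through their offset,
  -- and it gets harder to satisfy as the offset grows.
  dist≤r-near : ∀ i j i′ j′ → does (dist (i , j) (i′ , j′) ≤? r) ≡ does (near? j ∣ toℕ i - toℕ i′ ∣ j′)
  dist≤r-near i j i′ j′ = does-⇔ (mk⇔ to from) (dist (i , j) (i′ , j′) ≤? r) (near? j ∣ toℕ i - toℕ i′ ∣ j′)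
    where
    eq : Δ i i′ * Δ i i′ + Δ j j′ * Δ j j′ ≈ _ + Δ j j′ * Δ j j′
    eq = +-congʳ ([iε-jε]²≈[∣i-j∣ε]² ε (toℕ i) (toℕ i′))
    to : dist (i , j) (i′ , j′) ≤ r → Near j ∣ toℕ i - toℕ i′ ∣ j′
    to le = ≤-trans (≤-reflexive (≈-sym eq)) (√x≤y⇒x≤y² (0≤Δ²+Δ² i i′ j j′) le)
    from : Near j ∣ toℕ i - toℕ i′ ∣ j′ → dist (i , j) (i′ , j′) ≤ r
    from le = x≤y²⇒√x≤y (0≤Δ²+Δ² i i′ j j′) 0≤r (≤-trans (≤-reflexive eq) le)

  ∑-points : ∀ (f : Point → ℕ) → ℕ∑.∑ points f ≡ sum (λ i → sum (λ j → f (i , j)))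
  ∑-points f = ≡.trans (ℕ∑.∑-cartesianProductWith _,_ (allFin _) (allFin _) f)
    (≡.trans (ℕ∑.∑-cong (allFin (suc K)) (λ i → ∑-allFin (λ j → f (i , j)))) (∑-allFin {suc K} _))

  -- Counting Γ one column at a time: the column at offset `d` contributes `columnCount j d`, which
  -- is antitone in `d`, so `DistanceSum` applies to each row `j`.
  ∣Γ∣-distanceSum : ∀ i j → ∣Γ∣ (i , j) ≡ distanceSum (columnCount j) (suc K) (toℕ i)
  ∣Γ∣-distanceSum i j =
    ≡.trans (length-filter-∑ (λ y → dist (i , j) y ≤? r) points)
    (≡.trans (∑-points (λ y → indicator (dist (i , j) y ≤? r)))
    (sum-cong-≗ (λ i′ → sum-cong-≗ (λ j′ → ≡.cong (λ b → if b then 1 else 0) (dist≤r-near i j i′ j′)))))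

  -- The stationary mass of column `m` before division by `Z`.
  columnWeight : ℕ → ℕ
  columnWeight m = sum (λ j → distanceSum (columnCount j) (suc K) m)

  -- The factor 2 holds in every row separately and survives summation over the rows.
  columnWeight-≤-double : ∀ {m m′} → m ℕ.< suc K → m′ ℕ.< suc K → columnWeight m ℕ.≤ 2 ℕ.* columnWeight m′
  columnWeight-≤-double {m} {m′} m<N m′<N = ℕ.≤-trans
    (sum-mono (λ j → DistanceSum.distanceSum-≤-double (columnCount j) (columnCount-antitone j) m<N m′<N))
    (ℕ.≤-reflexive (≡.sym (*-distribˡ-sum {suc K} 2 (λ j → distanceSum (columnCount j) (suc K) m′))))

  ∣Γ∣-sum : (ℕ → ℕ) → ℕ
  ∣Γ∣-sum φ = ℕ∑.∑ points (λ x → φ (column x) ℕ.* ∣Γ∣ x)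

  ∣Γ∣-sum-columns : ∀ (φ : ℕ → ℕ) →
    ∣Γ∣-sum φ ≡ sumBelow (suc K) (λ m → φ m ℕ.* columnWeight m)
  ∣Γ∣-sum-columns φ = ≡.trans (∑-points (λ x → φ (column x) ℕ.* ∣Γ∣ x)) (sum-cong-≗ {suc K} (λ i →
    ≡.trans (sum-cong-≗ (λ j → ≡.cong (φ (toℕ i) ℕ.*_) (∣Γ∣-distanceSum i j)))
            (≡.sym (*-distribˡ-sum {suc K} (φ (toℕ i)) (λ j → distanceSum (columnCount j) (suc K) (toℕ i))))))

  Z : ℕ
  Z = ℕ∑.∑ points ∣Γ∣

  Z≡ : Z ≡ sumBelow (suc K) columnWeight
  Z≡ = ≡.trans (∑-points ∣Γ∣) (sum-cong-≗ {suc K} (λ i → sum-cong-≗ (λ j → ∣Γ∣-distanceSum i j)))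

  -- Mass outside each quarter

  open Blocks columnWeight (suc K) columnWeight-≤-double

  outsideA outsideB : ℕ → ℕ
  outsideA i = indicator (a ℕ.≤? i)
  outsideB i = indicator (i ℕ.<? b)

  -- The block bound is applied at offset 0. What remains are the last `b` columns, which are
  -- exactly those selected by `outsideA`.
  outsideA-small : 8 ℕ.* ∣Γ∣-sum outsideA ℕ.≤ 7 ℕ.* Z
  outsideA-small = ≡.subst₂ (λ s z → 8 ℕ.* s ℕ.≤ 7 ℕ.* z) (≡.sym rest≡) (≡.sym (≡.trans Z≡ split))
    (complement-small (sumBelow a columnWeight) (sumBelow b (λ i → columnWeight (a ℕ.+ i)))
      (≡.subst (ℕ._≤ 8 ℕ.* (sumBelow a columnWeight)) split (block-large 0 q fits 1+K≤4a)))
    where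
    rest≡ : ∣Γ∣-sum outsideA ≡ sumBelow b (λ i → columnWeight (a ℕ.+ i))
    rest≡ = ≡.trans (∣Γ∣-sum-columns outsideA)
      (≡.trans (≡.cong (λ N → sumBelow N (λ i → outsideA i ℕ.* columnWeight i)) (≡.sym a+b≡1+K))
               (sumBelow-indicator-≥ a b columnWeight))
    split : sumBelow (suc K) columnWeight ≡ sumBelow b (λ i → columnWeight (a ℕ.+ i)) ℕ.+ sumBelow a columnWeight
    split = ≡.trans (≡.cong (λ N → sumBelow N columnWeight) (≡.sym a+b≡1+K))
      (≡.trans (sumBelow-+ a b columnWeight) (ℕ.+-comm (sumBelow a columnWeight) _))
    fits : a ℕ.+ 0 ℕ.≤ suc K
    fits = ℕ.≤-trans (ℕ.≤-reflexive (ℕ.+-identityʳ a)) (s≤s q≤K)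

  -- The mirror case: the block starts at `b`, and `outsideB` selects the columns to its left.
  outsideB-small : 8 ℕ.* ∣Γ∣-sum outsideB ℕ.≤ 7 ℕ.* Z
  outsideB-small = ≡.subst₂ (λ s z → 8 ℕ.* s ℕ.≤ 7 ℕ.* z) (≡.sym rest≡) (≡.sym (≡.trans Z≡ split))
    (complement-small (sumBelow a (λ i → columnWeight (b ℕ.+ i))) (sumBelow b columnWeight)
      (≡.subst (ℕ._≤ 8 ℕ.* (sumBelow a (λ i → columnWeight (b ℕ.+ i)))) split (block-large b q (ℕ.≤-reflexive a+b≡1+K) 1+K≤4a)))
    where
    b+a≡1+K : b ℕ.+ a ≡ suc K
    b+a≡1+K = ≡.trans (ℕ.+-comm b a) a+b≡1+K
    rest≡ : ∣Γ∣-sum outsideB ≡ sumBelow b columnWeight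
    rest≡ = ≡.trans (∣Γ∣-sum-columns outsideB)
      (≡.trans (≡.cong (λ N → sumBelow N (λ i → outsideB i ℕ.* columnWeight i)) (≡.sym b+a≡1+K))
               (sumBelow-indicator-< b a columnWeight))
    split : sumBelow (suc K) columnWeight ≡ sumBelow b columnWeight ℕ.+ sumBelow a (λ i → columnWeight (b ℕ.+ i))
    split = ≡.trans (≡.cong (λ N → sumBelow N columnWeight) (≡.sym b+a≡1+K)) (sumBelow-+ b a columnWeight)

  -- Normalisation of the step law and the stationary law

  1≤∣Γ∣ : ∀ x → 1 ℕ.≤ ∣Γ∣ x
  1≤∣Γ∣ x@(i , j) = ∈-length (∈-filter⁺ (λ y → dist x y ≤? r) (∈-cartesianProduct⁺ (∈-allFin i) (∈-allFin j))
    -- The point `x` is itself in `Γ x`, being at distance 0.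
    (x≤y²⇒√x≤y (0≤Δ²+Δ² i i j j) 0≤r (begin
      Δ i i * Δ i i + Δ j j * Δ j j  ≈⟨ +-cong (*-congʳ (-‿inverseʳ _)) (*-congʳ (-‿inverseʳ _)) ⟩
      0# * Δ i i + 0# * Δ j j        ≈⟨ +-cong (zeroˡ _) (zeroˡ _) ⟩
      0# + 0#                        ≈⟨ +-identityˡ 0# ⟩
      0#                             ≤⟨ 0≤x*x r ⟩
      r * r                          ∎)))

  1≤Z : 1 ℕ.≤ Z
  1≤Z = ℕ.≤-trans (1≤∣Γ∣ (zero , zero)) (ℕ.m≤m+n _ _)

  step-total : ∀ x → ∑ points (step x) ≈ 1#
  step-total x = begin-equality
    ∑ points (step x)                                                 ≈⟨ ∑-cong points term ⟩
    ∑ points (λ y → fromℕ (indicator (dist x y ≤? r)) * (1# / ∣Γx∣))  ≈⟨ *-distribʳ-∑ _ points _ ⟨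
    ∑ points (λ y → fromℕ (indicator (dist x y ≤? r))) * (1# / ∣Γx∣)  ≈⟨ *-congʳ (fromℕ-∑ points (λ y → indicator (dist x y ≤? r))) ⟨
    fromℕ (ℕ∑.∑ points (λ y → indicator (dist x y ≤? r))) * (1# / ∣Γx∣)
      ≈⟨ *-congʳ (≈-reflexive (≡.cong fromℕ (length-filter-∑ (λ y → dist x y ≤? r) points))) ⟨
    ∣Γx∣ * (1# / ∣Γx∣)                                                ≈⟨ z*[x/z]≈x (fromℕ-≉0 (1≤∣Γ∣ x)) ⟩
    1#                                                                ∎
    where
    ∣Γx∣ = fromℕ (∣Γ∣ x)
    term : ∀ y → step x y ≈ fromℕ (indicator (dist x y ≤? r)) * (1# / ∣Γx∣)
    term y with does (dist x y ≤? r)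
    ... | true  = ≈-sym (≈-trans (*-congʳ fromℕ-1) (*-identityˡ _))
    ... | false = ≈-sym (zeroˡ _)

  -- The stationary expectation of `φ` of the column; for `outsideA` it is the probability that a
  -- single node starts outside A.
  mass : (ℕ → ℕ) → Carrier
  mass φ = ∑ points (λ x → fromℕ (φ (column x)) * stationary x)

  mass-∣Γ∣ : ∀ φ → mass φ ≈ fromℕ (∣Γ∣-sum φ) / fromℕ Z
  mass-∣Γ∣ φ = begin-equality
    ∑ points (λ x → fromℕ (φ (column x)) * (fromℕ (∣Γ∣ x) * fromℕ Z ⁻¹))
      ≈⟨ ∑-cong points (λ x → ≈-trans (≈-sym (*-assoc _ _ _)) (*-congʳ (≈-sym (fromℕ-* (φ (column x)) (∣Γ∣ x))))) ⟩
    ∑ points (λ x → fromℕ (φ (column x) ℕ.* ∣Γ∣ x) * fromℕ Z ⁻¹)   ≈⟨ *-distribʳ-∑ _ points _ ⟨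
    ∑ points (λ x → fromℕ (φ (column x) ℕ.* ∣Γ∣ x)) * fromℕ Z ⁻¹   ≈⟨ *-congʳ (fromℕ-∑ points (λ x → φ (column x) ℕ.* ∣Γ∣ x)) ⟨
    fromℕ (∣Γ∣-sum φ) / fromℕ Z   ∎

  mass-1 : mass (λ _ → 1) ≈ 1#
  mass-1 = begin-equality
    mass (λ _ → 1)                                      ≈⟨ mass-∣Γ∣ (λ _ → 1) ⟩
    fromℕ (∣Γ∣-sum (λ _ → 1)) / fromℕ Z   ≈⟨ *-congʳ (≈-reflexive (≡.cong fromℕ (ℕ∑.∑-cong points (λ x → ℕ.*-identityˡ (∣Γ∣ x))))) ⟩
    fromℕ Z / fromℕ Z                                   ≈⟨ *-inverseʳ _ (fromℕ-≉0 1≤Z) ⟩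
    1#                                                  ∎

  0≤Z⁻¹ : 0# ≤ fromℕ Z ⁻¹
  0≤Z⁻¹ = ⁻¹-nonneg (fromℕ-nonneg Z) (fromℕ-≉0 1≤Z)

  mass-nonneg : ∀ φ → 0# ≤ mass φ
  mass-nonneg φ = ≤-trans (*-nonneg (fromℕ-nonneg (∣Γ∣-sum φ)) 0≤Z⁻¹) (≤-reflexive (≈-sym (mass-∣Γ∣ φ)))

  mass-small : ∀ φ → 8 ℕ.* ∣Γ∣-sum φ ℕ.≤ 7 ℕ.* Z → fromℕ 8 * mass φ ≤ fromℕ 7
  mass-small φ le = begin
    fromℕ 8 * mass φ                     ≈⟨ *-congˡ (mass-∣Γ∣ φ) ⟩
    fromℕ 8 * (fromℕ s * fromℕ Z ⁻¹)     ≈⟨ *-assoc _ _ _ ⟨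
    fromℕ 8 * fromℕ s * fromℕ Z ⁻¹       ≈⟨ *-congʳ (fromℕ-* 8 s) ⟨
    fromℕ (8 ℕ.* s) * fromℕ Z ⁻¹         ≤⟨ *-monoʳ-≤ 0≤Z⁻¹ (fromℕ-mono le) ⟩
    fromℕ (7 ℕ.* Z) * fromℕ Z ⁻¹         ≈⟨ *-congʳ (fromℕ-* 7 Z) ⟩
    fromℕ 7 * fromℕ Z * fromℕ Z ⁻¹       ≈⟨ *-assoc _ _ _ ⟩
    fromℕ 7 * (fromℕ Z * fromℕ Z ⁻¹)     ≈⟨ *-congˡ (*-inverseʳ _ (fromℕ-≉0 1≤Z)) ⟩
    fromℕ 7 * 1#                         ≈⟨ *-identityʳ _ ⟩
    fromℕ 7                              ∎
    where s = ∣Γ∣-sum φ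

  -- Summing path weights over all prefixes

  nodeChain : ∀ {h} → Vec Config h → Fin n → Vec Point h
  nodeChain p i = Vec.map (λ c → lookup c i) p

  configs : List Config
  configs = allVecs points n

  -- The arbitrary factor `g` makes the induction work: it absorbs the first transition of every
  -- node, and the remaining steps are summed with this enlarged factor.
  steps-total : ∀ h (x : Config) (g : Fin n → Carrier) →
    ∑ (allVecs configs h) (λ p → ∏ (λ i → g i * stepsWeight (lookup x i) (nodeChain p i))) ≈ ∏ g
  steps-total zero    x g = ≈-trans (+-identityʳ _) (∏-cong {n} (λ i → *-identityʳ (g i)))
  steps-total (suc h) x g = begin-equality
    ∑ (allVecs configs (suc h)) (λ p → ∏ (λ i → g i * stepsWeight (lookup x i) (nodeChain p i)))
      ≈⟨ ∑-cartesianProductWith _∷_ configs (allVecs configs h) _ ⟩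
    ∑ configs (λ c → ∑ (allVecs configs h) (λ p →
      ∏ (λ i → g i * (step (lookup x i) (lookup c i) * stepsWeight (lookup c i) (nodeChain p i)))))
      ≈⟨ ∑-cong configs (λ c → ∑-cong (allVecs configs h) (λ p → ∏-cong {n} (λ i →
           *-assoc (g i) (step (lookup x i) (lookup c i)) (stepsWeight (lookup c i) (nodeChain p i))))) ⟨
    ∑ configs (λ c → ∑ (allVecs configs h) (λ p →
      ∏ (λ i → g i * step (lookup x i) (lookup c i) * stepsWeight (lookup c i) (nodeChain p i))))
      ≈⟨ ∑-cong configs (λ c → steps-total h c (λ i → g i * step (lookup x i) (lookup c i))) ⟩
    ∑ configs (λ c → ∏ (λ i → g i * step (lookup x i) (lookup c i)))
      -- The nodes move independently, so the sum over the next configuration factors into one sum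
      -- per node, each of total 1.
      ≈⟨ ∑-allVecs-∏ points (λ i y → g i * step (lookup x i) y) ⟩
    ∏ (λ i → ∑ points (λ y → g i * step (lookup x i) y))
      ≈⟨ ∏-cong {n} (λ i → *-distribˡ-∑ (g i) points (step (lookup x i))) ⟨
    ∏ (λ i → g i * ∑ points (step (lookup x i)))
      ≈⟨ ∏-cong {n} (λ i → ≈-trans (*-congˡ (step-total (lookup x i))) (*-identityʳ (g i))) ⟩
    ∏ g ∎

  -- For φ = outsideA this is the weight of p if A is empty at time 0, and 0 otherwise.
  tiltedWeight : ∀ {h} → (ℕ → ℕ) → Prefix h → Carrier
  tiltedWeight φ p = ∏ (λ i → fromℕ (φ (column (lookup (head p) i))) * chainWeight (nodeChain p i))

  -- The tilt depends on the initial configuration only. The later configurations are summed out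
  -- first; the initial positions then give `n` equal independent factors.
  tiltedWeight-total : ∀ h φ → ∑ (prefixes h) (tiltedWeight φ) ≈ ∏ {n} (λ _ → mass φ)
  tiltedWeight-total h φ = begin-equality
    ∑ (prefixes h) (tiltedWeight φ)
      ≈⟨ ∑-cartesianProductWith _∷_ configs (allVecs configs h) (tiltedWeight φ) ⟩
    ∑ configs (λ c → ∑ (allVecs configs h) (λ p → tiltedWeight φ (c ∷ p)))
      ≈⟨ ∑-cong configs tail-total ⟩
    ∑ configs (λ c → ∏ (λ i → initial (lookup c i)))
      ≈⟨ ∑-allVecs-∏ points (λ (_ : Fin n) → initial) ⟩
    ∏ {n} (λ _ → mass φ) ∎
    where
    initial : Point → Carrier
    initial x = fromℕ (φ (column x)) * stationary x
    tail-total : ∀ c → ∑ (allVecs configs h) (λ p → tiltedWeight φ (c ∷ p)) ≈ ∏ (λ i → initial (lookup c i))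
    tail-total c = ≈-trans
      (∑-cong (allVecs configs h) (λ p → ∏-cong {n} (λ i → ≈-sym
        (*-assoc (fromℕ (φ (column (lookup c i)))) (stationary (lookup c i)) (stepsWeight (lookup c i) (nodeChain p i))))))
      (steps-total h c (λ i → initial (lookup c i)))

  weight-∏ : ∀ {h} (p : Prefix h) → weight p ≡ ∏ (λ i → chainWeight (nodeChain p i))
  weight-∏ p = FoldrAllFin.foldr-allFin (CommutativeRing.*-commutativeMonoid commutativeRing) (λ i → chainWeight (nodeChain p i))

  tiltedWeight-≈ : ∀ {h} φ (p : Prefix h) → (∀ i → φ (column (lookup (head p) i)) ≡ 1) → tiltedWeight φ p ≈ weight p
  tiltedWeight-≈ φ p φ≡1 = ≈-trans
    (∏-cong (λ i → ≈-trans (*-congʳ (≈-trans (≈-reflexive (≡.cong fromℕ (φ≡1 i))) fromℕ-1)) (*-identityˡ _)))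
    (≈-reflexive (≡.sym (weight-∏ p)))

  weight-total : ∀ h → ∑ (prefixes h) weight ≈ 1#
  weight-total h = begin-equality
    ∑ (prefixes h) weight                     ≈⟨ ∑-cong (prefixes h) (λ p → tiltedWeight-≈ (λ _ → 1) p (λ _ → ≡.refl)) ⟨
    ∑ (prefixes h) (tiltedWeight (λ _ → 1))   ≈⟨ tiltedWeight-total h (λ _ → 1) ⟩
    ∏ {n} (λ _ → mass (λ _ → 1))              ≈⟨ ∏-cong {n} (λ _ → mass-1) ⟩
    ∏ {n} (λ _ → 1#)                          ≈⟨ ∏-one n ⟩
    1#                                        ∎

  step-nonneg : ∀ x y → 0# ≤ step x y
  step-nonneg x y with does (dist x y ≤? r)
  ... | true  = *-nonneg 0≤1 (⁻¹-nonneg (fromℕ-nonneg (∣Γ∣ x)) (fromℕ-≉0 (1≤∣Γ∣ x)))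
  ... | false = ≤-refl

  stepsWeight-nonneg : ∀ {h} x (ys : Vec Point h) → 0# ≤ stepsWeight x ys
  stepsWeight-nonneg x []       = 0≤1
  stepsWeight-nonneg x (y ∷ ys) = *-nonneg (step-nonneg x y) (stepsWeight-nonneg y ys)

  chainWeight-nonneg : ∀ {h} (xs : Vec Point (suc h)) → 0# ≤ chainWeight xs
  chainWeight-nonneg (x ∷ xs) = *-nonneg (*-nonneg (fromℕ-nonneg (∣Γ∣ x)) 0≤Z⁻¹) (stepsWeight-nonneg x xs)

  tiltedWeight-nonneg : ∀ {h} φ (p : Prefix h) → 0# ≤ tiltedWeight φ p
  tiltedWeight-nonneg φ p = ∏-nonneg (λ i →
    *-nonneg (fromℕ-nonneg (φ (column (lookup (head p) i)))) (chainWeight-nonneg (nodeChain p i)))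

  -- Speed of the nodes and of the information front

  Slow : Path → Set
  Slow ω = ∀ i t → Close r (pos ω i t) (pos ω i (suc t))

  Close-refl : ∀ x → Close r x x
  Close-refl x = x≤x+y _ 0≤r , x≤x+y _ 0≤r

  step≉0⇒Close : ∀ x y → ¬ (step x y ≈ 0#) → Close r x y
  step≉0⇒Close x y step≉0 with dist x y ≤? r
  ... | yes d≤r = dist≤⇒Close x y 0≤r d≤r
  ... | no  _   = ⊥-elim (step≉0 ≈-refl)

  -- A nonzero product has nonzero factors, so each transition has positive probability and hence
  -- length at most `r`.
  stepsWeight≉0⇒Close : ∀ {h} (x : Config) (ys : Vec Config h) i → ¬ (stepsWeight (lookup x i) (nodeChain ys i) ≈ 0#) →
    ∀ t → Close r (pos (extend (x ∷ ys)) i t) (pos (extend (x ∷ ys)) i (suc t))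
  -- Beyond its end a prefix is extended by repeating the last configuration, so the node stands
  -- still there.
  stepsWeight≉0⇒Close x []       i w≉0 t       = Close-refl (lookup x i)
  -- The first transition takes two clauses because `extend` at `y` reduces only once the rest of
  -- the prefix is known to be empty or not.
  stepsWeight≉0⇒Close x (y ∷ []) i w≉0 zero    = step≉0⇒Close (lookup x i) (lookup y i) (λ eq → w≉0 (≈-trans (*-congʳ eq) (zeroˡ _)))
  stepsWeight≉0⇒Close x (y ∷ _ ∷ _) i w≉0 zero = step≉0⇒Close (lookup x i) (lookup y i) (λ eq → w≉0 (≈-trans (*-congʳ eq) (zeroˡ _)))
  stepsWeight≉0⇒Close x (y ∷ ys) i w≉0 (suc t) =
    stepsWeight≉0⇒Close y ys i (λ eq → w≉0 (≈-trans (*-congˡ eq) (zeroʳ _))) t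

  weight≉0⇒Slow : ∀ {h} (p : Prefix h) → ¬ (weight p ≈ 0#) → Slow (extend p)
  weight≉0⇒Slow p@(x ∷ ys) w≉0 i = stepsWeight≉0⇒Close x ys i (λ eq →
    ∏-≉0 (λ eq′ → w≉0 (≈-trans (≈-reflexive (weight-∏ p)) eq′)) i (≈-trans (*-congˡ eq) (zeroʳ _)))

  extend-0 : ∀ {h} (p : Prefix h) → extend p 0 ≡ head p
  extend-0 (x ∷ [])    = ≡.refl
  extend-0 (x ∷ _ ∷ _) = ≡.refl

  -- Relates the position of a node in the right quarter at time `t` back to its start: it can have
  -- moved left by at most `r` per step.
  drift : ∀ ω → Slow ω → ∀ i t → X (pos ω i 0) ≤ X (pos ω i t) + fromℕ t * r
  drift ω slow i zero    = x≤x+y _ (≤-reflexive (≈-sym (zeroˡ r)))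
  drift ω slow i (suc t) = begin
    X (pos ω i 0)                               ≤⟨ drift ω slow i t ⟩
    X (pos ω i t) + fromℕ t * r                 ≤⟨ +-monoˡ-≤ _ (proj₁ (slow i t)) ⟩
    X (pos ω i (suc t)) + r + fromℕ t * r       ≈⟨ +-assoc _ _ _ ⟩
    X (pos ω i (suc t)) + (r + fromℕ t * r)     ≈⟨ +-congˡ (+-congʳ (*-identityˡ r)) ⟨
    X (pos ω i (suc t)) + (1# * r + fromℕ t * r) ≈⟨ +-congˡ (distribʳ _ _ _) ⟨
    X (pos ω i (suc t)) + (1# + fromℕ t) * r    ∎

  ∈N⇒ : ∀ ω t I {j} → j ∈ N ω t I → InNeighbourhood ω t I j
  ∈N⇒ ω t I {j} j∈N = does≡true⇒ (inNeighbourhood? ω t I j)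
    (≡.trans (≡.sym (Vec.lookup∘tabulate (λ j → does (inNeighbourhood? ω t I j)) j)) (Vec.[]=⇒lookup j∈N))

  -- One round is a hop of length at most `R` along an edge of the current graph, followed by a move
  -- of length at most `r`.
  front : ∀ ω → Slow ω → ∀ s t {j} → j ∈ informed ω s t → X (pos ω j t) ≤ X (pos ω s 0) + fromℕ t * (R + r)
  front ω slow s zero j∈ rewrite x∈⁅y⁆⇒x≡y s j∈ = x≤x+y _ (≤-reflexive (≈-sym (zeroˡ _)))
  front ω slow s (suc t) {j} j∈ = begin
    X (pos ω j (suc t))                                 ≤⟨ proj₂ (slow j t) ⟩
    X (pos ω j t) + r                                   ≤⟨ +-monoˡ-≤ r before ⟩
    X (pos ω s 0) + fromℕ t * (R + r) + R + r           ≈⟨ solve 4 (λ x T R r → x :+ T :* (R :+ r) :+ R :+ r := x :+ ((R :+ r) :+ T :* (R :+ r))) ≈-refl _ _ R r ⟩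
    X (pos ω s 0) + ((R + r) + fromℕ t * (R + r))       ≈⟨ +-congˡ (+-congʳ (*-identityˡ _)) ⟨
    X (pos ω s 0) + (1# * (R + r) + fromℕ t * (R + r))  ≈⟨ +-congˡ (distribʳ _ _ _) ⟨
    X (pos ω s 0) + (1# + fromℕ t) * (R + r)            ∎
    where
    before : X (pos ω j t) ≤ X (pos ω s 0) + fromℕ t * (R + r) + R
    before with x∈p∪q⁻ (informed ω s t) (N ω t (informed ω s t)) j∈
    ... | inj₁ j∈I = ≤-trans (front ω slow s t j∈I) (x≤x+y _ 0≤R)
    ... | inj₂ j∈N with _ , i , i∈I , _ , d≤R ← ∈N⇒ ω t (informed ω s t) j∈N =
      ≤-trans (proj₂ (dist≤⇒Close (pos ω i t) (pos ω j t) 0≤R d≤R)) (+-monoˡ-≤ R (front ω slow s t i∈I))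

  -- The gap between the two quarters

  √n : Carrier
  √n = √ fromℕ n

  1≤√n : 1# ≤ √n
  1≤√n = square-cancel-≤ (proj₁ spec) (begin
    1# * 1#    ≈⟨ *-identityˡ 1# ⟩
    1#         ≈⟨ fromℕ-1 ⟨
    fromℕ 1    ≤⟨ fromℕ-mono (ℕ.≤-trans (s≤s z≤n) 40≤n) ⟩
    fromℕ n    ≈⟨ proj₂ spec ⟨
    √n * √n    ∎)
    where spec = √-spec (fromℕ-nonneg n)

  ε*[√n/ε]≈√n : ε * (√n / ε) ≈ √n
  ε*[√n/ε]≈√n = z*[x/z]≈x ε≉0

  -- Since `ε ≤ 1 ≤ √n`, the grid has at least two columns.
  1≤K : 1 ℕ.≤ K
  1≤K = ⌊⌋-max 1 (*-cancelˡ-≤ 0≤ε ε≉0 (begin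
    ε * fromℕ 1     ≈⟨ *-congˡ fromℕ-1 ⟩
    ε * 1#          ≈⟨ *-identityʳ ε ⟩
    ε               ≤⟨ ε≤1 ⟩
    1#              ≤⟨ 1≤√n ⟩
    √n              ≈⟨ ε*[√n/ε]≈√n ⟨
    ε * (√n / ε)    ∎))

  √n/ε≤1+K : √n / ε ≤ fromℕ (suc K)
  √n/ε≤1+K with total (√n / ε) (fromℕ (suc K))
  ... | inj₁ le = le
  ... | inj₂ ge = ⊥-elim (ℕ.<-irrefl ≡.refl (⌊⌋-max (suc K) ge))

  -- Rounding down to the grid loses less than one column width, hence at most a factor 2 because
  -- `K` is at least 1.
  √n≤2Kε : √n ≤ fromℕ 2 * (fromℕ K * ε)
  √n≤2Kε = begin
    √n                        ≈⟨ ε*[√n/ε]≈√n ⟨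
    ε * (√n / ε)              ≤⟨ *-monoˡ-≤ 0≤ε √n/ε≤1+K ⟩
    ε * fromℕ (suc K)         ≤⟨ *-monoˡ-≤ 0≤ε (fromℕ-mono 1+K≤2K) ⟩
    ε * fromℕ (2 ℕ.* K)       ≈⟨ *-congˡ (fromℕ-* 2 K) ⟩
    ε * (fromℕ 2 * fromℕ K)   ≈⟨ solve 3 (λ e t k → e :* (t :* k) := t :* (k :* e)) ≈-refl ε _ _ ⟩
    fromℕ 2 * (fromℕ K * ε)   ∎
    where
    1+K≤2K : suc K ℕ.≤ 2 ℕ.* K
    1+K≤2K = ℕ.≤-trans (ℕ.+-monoˡ-≤ K 1≤K) (ℕ.≤-reflexive (≡.cong (K ℕ.+_) (≡.sym (ℕ.+-identityʳ K))))

  -- From `i ≤ q` and `K - q ≤ j`, the gap is at least `K - 2q`, and `4q ≤ K` makes this at least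
  -- `K / 2`. The statement is doubled to stay in the naturals, and `2 * q` is added to both sides
  -- to avoid truncated subtraction.
  columns-apart : ∀ {i j} → i ℕ.< a → b ℕ.≤ j → K ℕ.+ 2 ℕ.* i ℕ.≤ 2 ℕ.* j
  columns-apart {i} {j} (s≤s i≤q) b≤j = ℕ.+-cancelʳ-≤ (2 ℕ.* q) _ _ (
    ℕ.≤-trans (ℕ.+-monoˡ-≤ (2 ℕ.* q) (ℕ.+-monoʳ-≤ K (ℕ.*-monoʳ-≤ 2 i≤q)))
    (ℕ.≤-trans (ℕ.≤-reflexive (regroup K q))
    (ℕ.≤-trans (ℕ.+-monoʳ-≤ K 4q≤K)
    (ℕ.≤-trans (ℕ.≤-reflexive (≡.trans (≡.cong (K ℕ.+_) (≡.sym (ℕ.+-identityʳ K))) (≡.cong (2 ℕ.*_) (≡.sym (ℕ.m∸n+n≡m q≤K)))))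
    (ℕ.≤-trans (ℕ.*-monoʳ-≤ 2 (ℕ.+-monoˡ-≤ q b≤j)) (ℕ.≤-reflexive (ℕ.*-distribˡ-+ 2 j q)))))))
    where
    regroup : ∀ K q → K ℕ.+ 2 ℕ.* q ℕ.+ 2 ℕ.* q ≡ K ℕ.+ 4 ℕ.* q
    regroup = ℕ-Solver.solve-∀

  -- Flooding from `u` must inform `v` at some time `t′ ≤ t`. With `T = t′(R + r)`, the front has
  -- advanced by at most `T` and `v` has retreated by at most `T`, so half the width `Kε` is at most
  -- `2T`. Together with `√n ≤ 2Kε` this gives `√n ≤ 8T`, the origin of the constant 8.
  spread⇒slow-flooding : ∀ {ω} → Slow ω → ∀ u v → column (pos ω u 0) ℕ.< a → b ℕ.≤ column (pos ω v 0) →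
    FloodingTimeAtLeast (fromℕ 8 ⁻¹ * (√n / (R + r))) ω
  spread⇒slow-flooding {ω} slow u v u∈A v∈B t (complete , _)
    with t′ , s≤s t′≤t , full , _ ← complete u = begin
      fromℕ 8 ⁻¹ * (√n / (R + r))  ≈⟨ *-comm _ _ ⟩
      √n / (R + r) / fromℕ 8       ≤⟨ x≤z*y⇒x/z≤y (fromℕ-nonneg 8) (fromℕ-≉0 {8} (s≤s z≤n)) (x≤z*y⇒x/z≤y 0≤R+r R+r≉0 √n≤) ⟩
      fromℕ t′                     ≤⟨ fromℕ-mono t′≤t ⟩
      fromℕ t                      ∎
    where
    i j : ℕ
    i = column (pos ω u 0)
    j = column (pos ω v 0)
    two T : Carrier
    two = fromℕ 2
    T = fromℕ t′ * (R + r)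
    v-informed : v ∈ informed ω u t′
    v-informed = ≡.subst (v ∈_) (≡.sym full) ∈⊤
    near : fromℕ j * ε ≤ fromℕ i * ε + two * T
    near = begin
      fromℕ j * ε                           ≤⟨ drift ω slow v t′ ⟩
      -- The drift `t′ r` of `v` is relaxed to `T`, so that both motions share one bound.
      X (pos ω v t′) + fromℕ t′ * r         ≤⟨ +-mono-≤ (front ω slow u t′ v-informed) (*-monoˡ-≤ (fromℕ-nonneg t′) (≤-trans (x≤x+y r 0≤R) (≤-reflexive (+-comm r R)))) ⟩
      fromℕ i * ε + T + T                   ≈⟨ +-assoc _ _ _ ⟩
      fromℕ i * ε + (T + T)                 ≈⟨ +-congˡ (fromℕ-2-* T) ⟨
      fromℕ i * ε + two * T                 ∎
    Kε≤ : fromℕ K * ε ≤ two * (two * T)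
    Kε≤ = +-cancelʳ-≤ (two * (fromℕ i * ε)) (begin
      fromℕ K * ε + two * (fromℕ i * ε)             ≈⟨ +-congˡ (≈-sym (*-assoc _ _ _)) ⟩
      fromℕ K * ε + two * fromℕ i * ε               ≈⟨ distribʳ _ _ _ ⟨
      (fromℕ K + two * fromℕ i) * ε                 ≈⟨ *-congʳ (≈-trans (fromℕ-+ K (2 ℕ.* i)) (+-congˡ (fromℕ-* 2 i))) ⟨
      fromℕ (K ℕ.+ 2 ℕ.* i) * ε                     ≤⟨ *-monoʳ-≤ 0≤ε (fromℕ-mono (columns-apart u∈A v∈B)) ⟩
      fromℕ (2 ℕ.* j) * ε                           ≈⟨ ≈-trans (*-congʳ (fromℕ-* 2 j)) (*-assoc _ _ _) ⟩
      two * (fromℕ j * ε)                           ≤⟨ *-monoˡ-≤ (fromℕ-nonneg 2) near ⟩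
      two * (fromℕ i * ε + two * T)                 ≈⟨ ≈-trans (distribˡ _ _ _) (+-comm _ _) ⟩
      two * (two * T) + two * (fromℕ i * ε)         ∎)
    √n≤ : √n ≤ (R + r) * (fromℕ 8 * fromℕ t′)
    √n≤ = begin
      √n                                  ≤⟨ √n≤2Kε ⟩
      two * (fromℕ K * ε)                 ≤⟨ *-monoˡ-≤ (fromℕ-nonneg 2) Kε≤ ⟩
      two * (two * (two * T))             ≈⟨ solve 3 (λ a t s → a :* (a :* (a :* (t :* s))) := s :* ((a :* (a :* a)) :* t)) ≈-refl two (fromℕ t′) (R + r) ⟩
      (R + r) * (two * (two * two) * fromℕ t′)  ≈⟨ *-congˡ (*-congʳ (≈-trans (fromℕ-* 2 4) (*-congˡ (fromℕ-* 2 2)))) ⟨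
      (R + r) * (fromℕ 8 * fromℕ t′)      ∎

  -- The probability of fast flooding

  threshold : Carrier
  threshold = fromℕ 8 ⁻¹ * (√n / (R + r))

  -- Fast flooding leaves three possibilities: A is empty at time 0, B is empty at time 0, or the
  -- prefix has weight zero. In the first two the matching tilted weight equals `weight p`.
  fast⇒unspread : ∀ {h} (p : Prefix h) → ¬ FloodingTimeAtLeast threshold (extend p) →
    weight p ≤ tiltedWeight outsideA p + tiltedWeight outsideB p
  fast⇒unspread p fast
    with Fin.all? (λ i → a ℕ.≤? column (lookup (head p) i)) | Fin.all? (λ i → column (lookup (head p) i) ℕ.<? b) | weight p ≟ 0#
  ... | yes noA | _ | _ = begin
    weight p                 ≈⟨ tiltedWeight-≈ outsideA p (λ i → indicator-yes (a ℕ.≤? column (lookup (head p) i)) (noA i)) ⟨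
    tiltedWeight outsideA p  ≤⟨ x≤x+y _ (tiltedWeight-nonneg outsideB p) ⟩
    tiltedWeight outsideA p + tiltedWeight outsideB p ∎
  ... | no _ | yes noB | _ = begin
    weight p                 ≈⟨ tiltedWeight-≈ outsideB p (λ i → indicator-yes (column (lookup (head p) i) ℕ.<? b) (noB i)) ⟨
    tiltedWeight outsideB p  ≤⟨ x≤x+y _ (tiltedWeight-nonneg outsideA p) ⟩
    tiltedWeight outsideB p + tiltedWeight outsideA p ≈⟨ +-comm _ _ ⟩
    tiltedWeight outsideA p + tiltedWeight outsideB p ∎
  ... | no _ | no _ | yes w≈0 =
    ≤-trans (≤-reflexive w≈0) (+-nonneg (tiltedWeight-nonneg outsideA p) (tiltedWeight-nonneg outsideB p))
  -- Both quarters are occupied and the weight is nonzero, so flooding from `u` is slow,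
  -- contradicting `fast`.
  ... | no someA | no someB | no w≉0
    with u , u∈A ← Fin.¬∀⟶∃¬ n _ (λ i → a ℕ.≤? column (lookup (head p) i)) someA
       | v , v∈B ← Fin.¬∀⟶∃¬ n _ (λ i → column (lookup (head p) i) ℕ.<? b) someB =
    ⊥-elim (fast (spread⇒slow-flooding (weight≉0⇒Slow p w≉0) u v
      (≡.subst (λ c → column (lookup c u) ℕ.< a) (≡.sym (extend-0 p)) (ℕ.≰⇒> u∈A))
      (≡.subst (λ c → b ℕ.≤ column (lookup c v)) (≡.sym (extend-0 p)) (ℕ.≮⇒≥ v∈B))))

  failure : Carrier
  failure = ∏ {n} (λ _ → mass outsideA) + ∏ {n} (λ _ → mass outsideB)

  -- The pointwise union bound is summed over all prefixes, whose total weight is 1.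
  1≤ℙ+failure : 1# ≤ ℙ (floodingTime≥ threshold) + failure
  1≤ℙ+failure = begin
    1#                                   ≈⟨ weight-total h ⟨
    ∑ (prefixes h) weight                ≤⟨ ∑-mono (prefixes h) pointwise ⟩
    ∑ (prefixes h) (λ p → success p + (tiltedWeight outsideA p + tiltedWeight outsideB p))
      ≈⟨ ∑-distrib-+ (prefixes h) success (λ p → tiltedWeight outsideA p + tiltedWeight outsideB p) ⟩
    ∑ (prefixes h) success + ∑ (prefixes h) (λ p → tiltedWeight outsideA p + tiltedWeight outsideB p)
      ≈⟨ +-congˡ (≈-trans (∑-distrib-+ (prefixes h) (tiltedWeight outsideA) (tiltedWeight outsideB))
                          (+-cong (tiltedWeight-total h outsideA) (tiltedWeight-total h outsideB))) ⟩
    ℙ (floodingTime≥ threshold) + failure ∎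
    where
    h : ℕ
    -- This is the horizon of `floodingTime≥ threshold`, so the sum of `success` is its probability
    -- by definition.
    h = proj₁ (archimedean threshold)
    success : Prefix h → Carrier
    success p = if does (floodingTimeAtLeast? threshold (extend p)) then weight p else 0#
    pointwise : ∀ p → weight p ≤ success p + (tiltedWeight outsideA p + tiltedWeight outsideB p)
    pointwise p = if-does-bound (floodingTimeAtLeast? threshold (extend p))
      (+-nonneg (tiltedWeight-nonneg outsideA p) (tiltedWeight-nonneg outsideB p)) (fast⇒unspread p)

  -- Each of the two powers is at most 1/(2n), since its base is at most 7/8 and `n` is at least 40.
  failure≤1/n : failure ≤ 1# / fromℕ n
  failure≤1/n = *-cancelˡ-≤ (fromℕ-nonneg (2 ℕ.* n)) (fromℕ-≉0 1≤2n) (begin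
    fromℕ (2 ℕ.* n) * failure   ≈⟨ distribˡ _ _ _ ⟩
    fromℕ (2 ℕ.* n) * ∏ {n} (λ _ → mass outsideA) + fromℕ (2 ℕ.* n) * ∏ {n} (λ _ → mass outsideB)
      ≤⟨ +-mono-≤ (∏-const-small 40≤n (mass-nonneg outsideA) (mass-small outsideA outsideA-small))
                  (∏-const-small 40≤n (mass-nonneg outsideB) (mass-small outsideB outsideB-small)) ⟩
    1# + 1#                             ≈⟨ fromℕ-2-* 1# ⟨
    fromℕ 2 * 1#                        ≈⟨ *-congˡ (z*[x/z]≈x (fromℕ-≉0 1≤n)) ⟨
    fromℕ 2 * (fromℕ n * (1# / fromℕ n)) ≈⟨ *-assoc _ _ _ ⟨
    fromℕ 2 * fromℕ n * (1# / fromℕ n)  ≈⟨ *-congʳ (fromℕ-* 2 n) ⟨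
    fromℕ (2 ℕ.* n) * (1# / fromℕ n)    ∎)
    where
    1≤n : 1 ℕ.≤ n
    1≤n = ℕ.≤-trans (s≤s z≤n) 40≤n
    1≤2n : 1 ℕ.≤ 2 ℕ.* n
    1≤2n = ℕ.≤-trans 1≤n (ℕ.m≤m+n n _)

  ℙ-bound : 1# - 1# / fromℕ n ≤ ℙ (floodingTime≥ threshold)
  ℙ-bound = x≤y+z⇒x-z≤y (≤-trans 1≤ℙ+failure (+-monoʳ-≤ _ failure≤1/n))

mainTheorem9 : (𝓡 : CompleteOrderedField) →
    let open CompleteOrderedField 𝓡
        open RealFunctions 𝓡 using (√_)
    in ∃ λ (c : Carrier) → 0# < c × (∃ λ (n₀ : ℕ) →
         ∀ (n : ℕ) → n₀ ℕ.≤ n →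
         ∀ (r R ε : Carrier) → 0# ≤ r → 0# < ε → ε ≤ 1# → ε < R →
         let open GeometricMEG 𝓡 n r R ε
         in 1# - 1# / fromℕ n ≤ ℙ (floodingTime≥ (c * (√ fromℕ n / (R + r)))))
-- The constant 1/8 comes from `spread⇒slow-flooding`, and 40 from `2n7ⁿ≤8ⁿ`.
mainTheorem9 𝓡 = fromℕ 8 ⁻¹ , (⁻¹-nonneg (fromℕ-nonneg 8) 8≉0 , 0≉8⁻¹) , 40 ,
  λ n 40≤n r R ε 0≤r 0<ε ε≤1 ε<R → FloodingLowerBound.ℙ-bound 𝓡 n r R ε 0≤r 0<ε ε≤1 ε<R 40≤n
  where
  open CompleteOrderedField 𝓡
  open RealFunctions 𝓡
  open RealProperties 𝓡
  open CommutativeRing commutativeRing using (*-congˡ; zeroʳ) renaming (sym to ≈-sym; trans to ≈-trans)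
  8≉0 : ¬ (fromℕ 8 ≈ 0#)
  8≉0 = fromℕ-≉0 {8} (s≤s z≤n)
  0≉8⁻¹ : ¬ (0# ≈ fromℕ 8 ⁻¹)
  0≉8⁻¹ eq = 0≉1 (≈-trans (≈-sym (zeroʳ (fromℕ 8))) (≈-trans (*-congˡ eq) (*-inverseʳ (fromℕ 8) 8≉0)))
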